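{- The reachability problem E-E-Reach is undecidable for the class UCST[$\mathcal{P}_1^{\mathtt r}$], and it is also undecidable for the class UCST[$\mathcal{H}_1^{\mathtt r}$]. Here UCST[$\mathcal{P}_1^{\mathtt r}$] (respectively UCST[$\mathcal{H}_1^{\mathtt r}$]) is the class of UCSTs in which the only tests are parity tests (respectively head tests) performed by Sender on the reliable channel $\mathtt r$.
   Context: A UCST (unidirectional channel system with tests) is a tuple $S=(\{\mathtt r,\mathtt l\},M,Q_1,\Delta_1,Q_2,\Delta_2)$ where $M$ is a finite message alphabet, $Q_1,Q_2$ are disjoint finite sets of states of Sender and Receiver respectively, and $\Delta_1,\Delta_2$ are finite sets of rules of Sender and Receiver. There are two channels: $\mathtt r$ (reliable) and $\mathtt l$ (lossy). A rule in $\Delta_i$ is a tuple $(q,\mathtt c,\alpha,q')\in Q_i\times\{\mathtt r,\mathtt l\}\times \mathrm{Act}\times Q_i$ with $\mathrm{Act}=\mathrm{Reg}(M)\cup M\cup\{\epsilon\}$, where $\mathrm{Reg}(M)$ is the set of regular languages over $M$ (finitely represented). If $\alpha=R\in\mathrm{Reg}(M)$ the rule is a test on $\mathtt c$; if $\alpha=x\in M\cup\{\epsilon\}$ it is a write $\mathtt c!x$ when in $\Delta_1$ and a read $\mathtt c?x$ when in $\Delta_2$ ($\alpha=\epsilon$ is the empty action). Configurations are tuples $(q_1,q_2,u,v)\in Q_1\times Q_2\times M^*\times M^*$ ($u$ is the content of $\mathtt r$, $v$ that of $\mathtt l$). Reliable steps: a rule $(q,\mathtt c,\alpha,q')$ of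 Sender (respectively Receiver) can be fired if $q$ is the current Sender (respectively Receiver) state, which becomes $q'$, the other agent's state being unchanged; a test $R$ on $\mathtt c$ requires the content of $\mathtt c$ to be in $R$ and changes no content; a write $\mathtt c!x$ appends $x$ at the right end of the content of $\mathtt c$; a read $\mathtt c?x$ requires $x$ to be a prefix of the content of $\mathtt c$ and removes it. Loss steps: $(q_1,q_2,u,v)\to(q_1,q_2,u,v')$ whenever $v'$ is obtained from $v$ by deleting one occurrence of a symbol. A step is a reliable step or a loss step; a run $C\xrightarrow{*}D$ is a finite sequence of chained steps. E-E-Reach: given a UCST $S$ and states $p_{\mathrm{in}},p_{\mathrm{fi}}\in Q_1$, $q_{\mathrm{in}},q_{\mathrm{fi}}\in Q_2$, is there a run $(p_{\mathrm{in}},q_{\mathrm{in}},\epsilon,\epsilon)\xrightarrow{*}(p_{\mathrm{fi}},q_{\mathrm{fi}},\epsilon,\epsilon)$ in $S$? Parity tests: $\mathcal P=\{\mathit{Even},\mathit{Odd}\}$ with $\mathit{Even}=(M\cdot M)^*$ and $\mathit{Odd}=M\cdot\mathit{Even}$. Head tests: $\mathcal H=\{H_a\mid a\in M\}$ with $H_a=a\cdot M^*$. The subscript $1$ restricts tests to Sender, the superscript $\mathtt r$ restricts tests to channel $\mathtt r$. -}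

module Defs where

open import Data.Bool.Base using (Bool; true; false)
open import Data.Empty using (⊥)
open import Data.Fin.Base using (Fin; toℕ)
open import Data.Fin.Properties using (≤-preorder)
open import Data.List.Base using (List; []; _∷_; _++_; [_]; map)
open import Data.List.Membership.Propositional using (_∈_)
open import Data.List.Relation.Unary.All using (All)
open import Data.Nat.Base using (ℕ; zero; suc)
open import Data.Product.Base using (_×_; _,_; ∃; ∃-syntax)
open import Data.Sum.Base using (_⊎_; inj₁; inj₂)
open import Data.Unit.Base using (⊤)
open import Relation.Binary.Construct.Closure.ReflexiveTransitive using (Star)
open import Relation.Binary.PropositionalEquality.Core using (_≡_)
open import Relation.Nullary.Negation.Core using (¬_)
open import Relation.Unary using (_≐_)
import Text.Regex.Base

------------------------------------------------------------------------
-- Regular languages over the alphabet Fin m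

module RE {m : ℕ} = Text.Regex.Base (≤-preorder m)

Reg : ℕ → Set
Reg m = RE.Exp {m}

Language : {m : ℕ} → Reg m → List (Fin m) → Set
Language R w = w RE.∈ R

-- The complement of the empty range: any single letter.
anyLetter : {m : ℕ} → Reg m
anyLetter = RE.[^ [] ]

even odd : {m : ℕ} → Reg m
even = (anyLetter RE.∙ anyLetter) RE.⋆
odd  = anyLetter RE.∙ even

head : {m : ℕ} → Fin m → Reg m
head a = RE.[ RE.Range.[ a ] ∷ [] ] RE.∙ (anyLetter RE.⋆)

-- Tests are languages, so membership in a family of tests does not
-- depend on the expression that represents the language.

IsParityTest IsHeadTest : {m : ℕ} → Reg m → Set
IsParityTest R = (Language R ≐ Language even) ⊎ (Language R ≐ Language odd)
IsHeadTest   R = ∃[ a ] (Language R ≐ Language (head a))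

------------------------------------------------------------------------
-- Unidirectional channel systems with tests

data Channel : Set where
  r l : Channel

data Act (m : ℕ) : Set where
  test : Reg m → Act m
  msg  : Fin m → Act m
  ε    : Act m

record Rule (m n : ℕ) : Set where
  constructor rule
  field
    source  : Fin n
    channel : Channel
    action  : Act m
    target  : Fin n

record UCST : Set where
  constructor ucst
  field
    #messages #states₁ #states₂ : ℕ
    Δ₁ : List (Rule #messages #states₁)
    Δ₂ : List (Rule #messages #states₂)

module Semantics (S : UCST) where
  open UCST S

  Word : Set
  Word = List (Fin #messages)

  record Config : Set where
    constructor config
    field
      state₁ : Fin #states₁
      state₂ : Fin #states₂
      onR onL : Word

  -- Effect of an action on the content of the channel it is applied to.

  data SenderEffect : Act #messages → Word → Word → Set where
    test  : ∀ {R w} → Language R w → SenderEffect (test R) w w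
    write : ∀ {x w} → SenderEffect (msg x) w (w ++ [ x ])
    ε     : ∀ {w} → SenderEffect ε w w

  data ReceiverEffect : Act #messages → Word → Word → Set where
    test : ∀ {R w} → Language R w → ReceiverEffect (test R) w w
    read : ∀ {x w} → ReceiverEffect (msg x) (x ∷ w) w
    ε    : ∀ {w} → ReceiverEffect ε w w

  infix 4 _⟶_ _⟶*_

  data _⟶_ : Config → Config → Set where
    senderR : ∀ {p p′ α q u u′ v} →
      rule p r α p′ ∈ Δ₁ → SenderEffect α u u′ →
      config p q u v ⟶ config p′ q u′ v
    senderL : ∀ {p p′ α q u v v′} →
      rule p l α p′ ∈ Δ₁ → SenderEffect α v v′ →
      config p q u v ⟶ config p′ q u v′
    receiverR : ∀ {p q q′ α u u′ v} →
      rule q r α q′ ∈ Δ₂ → ReceiverEffect α u u′ →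
      config p q u v ⟶ config p q′ u′ v
    receiverL : ∀ {p q q′ α u v v′} →
      rule q l α q′ ∈ Δ₂ → ReceiverEffect α v v′ →
      config p q u v ⟶ config p q′ u v′
    loss : ∀ {p q u} (v₁ : Word) (x : Fin #messages) (v₂ : Word) →
      config p q u (v₁ ++ [ x ] ++ v₂) ⟶ config p q u (v₁ ++ v₂)

  _⟶*_ : Config → Config → Set
  _⟶*_ = Star _⟶_

------------------------------------------------------------------------
-- Classes of UCSTs

-- UCST[ 𝒯 ]₁ʳ : tests occur only in Sender rules, only on channel r, and
-- only with languages in 𝒯.

module _ (𝒯 : {m : ℕ} → Reg m → Set) where

  SenderRuleOK : {m n : ℕ} → Rule m n → Set
  SenderRuleOK (rule _ r (test R) _) = 𝒯 R
  SenderRuleOK (rule _ l (test _) _) = ⊥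
  SenderRuleOK (rule _ _ (msg _)  _) = ⊤
  SenderRuleOK (rule _ _ ε        _) = ⊤

  ReceiverRuleOK : {m n : ℕ} → Rule m n → Set
  ReceiverRuleOK (rule _ _ (test _) _) = ⊥
  ReceiverRuleOK (rule _ _ (msg _)  _) = ⊤
  ReceiverRuleOK (rule _ _ ε        _) = ⊤

  UCST[_]₁ʳ : UCST → Set
  UCST[_]₁ʳ S = All SenderRuleOK (UCST.Δ₁ S) × All ReceiverRuleOK (UCST.Δ₂ S)

------------------------------------------------------------------------
-- The problem E-E-Reach

record Instance : Set where
  constructor inst
  field
    system : UCST
  open UCST system public
  field
    p-in p-fi : Fin #states₁
    q-in q-fi : Fin #states₂

E-E-Reach : Instance → Set
E-E-Reach I = config p-in q-in [] [] ⟶* config p-fi q-fi [] []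
  where
  open Instance I
  open Semantics system

------------------------------------------------------------------------
-- Binary encoding of instances

-- Every code below is self-delimiting: a constructor tag followed by the
-- codes of the arguments, with numbers in unary. Alphabets and state sets
-- are given by their cardinalities.

encodeℕ : ℕ → List Bool
encodeℕ zero    = [ false ]
encodeℕ (suc n) = true ∷ encodeℕ n

encodeFin : {n : ℕ} → Fin n → List Bool
encodeFin i = encodeℕ (toℕ i)

encodeList : {A : Set} → (A → List Bool) → List A → List Bool
encodeList enc []       = [ false ]
encodeList enc (x ∷ xs) = true ∷ enc x ++ encodeList enc xs

encodeRange : {m : ℕ} → RE.Range {m} → List Bool
encodeRange RE.Range.[ a ] = false ∷ encodeFin a
encodeRange (a RE.─ b)     = true ∷ encodeFin a ++ encodeFin b

encodeReg : {m : ℕ} → Reg m → List Bool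
encodeReg RE.ε           = false ∷ false ∷ false ∷ []
encodeReg RE.Exp.[ rs ]  = false ∷ false ∷ true  ∷ encodeList encodeRange rs
encodeReg RE.[^ rs ]     = false ∷ true  ∷ false ∷ encodeList encodeRange rs
encodeReg (R₁ RE.∣ R₂)   = false ∷ true  ∷ true  ∷ encodeReg R₁ ++ encodeReg R₂
encodeReg (R₁ RE.∙ R₂)   = true  ∷ false ∷ false ∷ encodeReg R₁ ++ encodeReg R₂
encodeReg (R RE.⋆)       = true  ∷ false ∷ true  ∷ encodeReg R

encodeChannel : Channel → List Bool
encodeChannel r = [ false ]
encodeChannel l = [ true ]

encodeAct : {m : ℕ} → Act m → List Bool
encodeAct (test R) = false ∷ false ∷ encodeReg R
encodeAct (msg x)  = false ∷ true  ∷ encodeFin x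
encodeAct ε        = true  ∷ false ∷ []

encodeRule : {m n : ℕ} → Rule m n → List Bool
encodeRule (rule q c α q′) =
  encodeFin q ++ encodeChannel c ++ encodeAct α ++ encodeFin q′

encode : Instance → List Bool
encode I =
  encodeℕ #messages ++ encodeℕ #states₁ ++ encodeℕ #states₂ ++
  encodeFin p-in ++ encodeFin p-fi ++ encodeFin q-in ++ encodeFin q-fi ++
  encodeList encodeRule Δ₁ ++ encodeList encodeRule Δ₂
  where open Instance I

------------------------------------------------------------------------
-- Deterministic single-tape Turing machines over the input alphabet Bool

data Control (n : ℕ) : Set where
  run           : Fin n → Control n
  accept reject : Control n

data Move : Set where
  left right : Move

data Symbol (k : ℕ) : Set where
  blank : Symbol k
  input : Bool → Symbol k
  work  : Fin k → Symbol k

record TM : Set where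
  field
    #states #work : ℕ
    start : Fin #states
    δ     : Fin #states → Symbol #work →
            Control #states × Symbol #work × Move

-- The tape is infinite in both directions; only a finite part is stored,
-- and everything beyond it is blank. The cells to the left of the head
-- are listed from right to left.

record Tape (k : ℕ) : Set where
  constructor tape
  field
    leftOf  : List (Symbol k)
    scanned : Symbol k
    rightOf : List (Symbol k)

fromRight : {k : ℕ} → List (Symbol k) → List (Symbol k) → Tape k
fromRight ls []       = tape ls blank []
fromRight ls (s ∷ rs) = tape ls s rs

writeMove : {k : ℕ} → Symbol k → Move → Tape k → Tape k
writeMove s right (tape ls       _ rs) = fromRight (s ∷ ls) rs
writeMove s left  (tape []       _ rs) = tape [] blank (s ∷ rs)
writeMove s left  (tape (t ∷ ls) _ rs) = tape ls t (s ∷ rs)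

module Computation (T : TM) where
  open TM T

  TMConfig : Set
  TMConfig = Control #states × Tape #work

  initial : List Bool → TMConfig
  initial w = run start , fromRight [] (map input w)

  infix 4 _⊢_

  data _⊢_ : TMConfig → TMConfig → Set where
    step : ∀ {q t c s d} → δ q (Tape.scanned t) ≡ (c , s , d) →
           (run q , t) ⊢ (c , writeMove s d t)

  Accepts Rejects : List Bool → Set
  Accepts w = ∃[ t ] Star _⊢_ (initial w) (accept , t)
  Rejects w = ∃[ t ] Star _⊢_ (initial w) (reject , t)

------------------------------------------------------------------------
-- Undecidability of E-E-Reach for a class of UCSTs

-- A decider need only behave correctly on codes of instances whose system
-- is in the class.

DecidesE-E-Reach : (UCST → Set) → TM → Set
DecidesE-E-Reach 𝒞 T = (I : Instance) → 𝒞 (Instance.system I) →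
  (E-E-Reach I → Accepts (encode I)) × (¬ E-E-Reach I → Rejects (encode I))
  where open Computation T

E-E-ReachUndecidable : (UCST → Set) → Set
E-E-ReachUndecidable 𝒞 = ¬ (∃[ T ] DecidesE-E-Reach 𝒞 T)

{-# OPTIONS --safe #-}
-- A Sender can use the reliable channel as the queue of a queue automaton. It
-- names the message to be read on the lossy channel, Receiver obeys, and a test
-- on the reliable channel tells Sender that the read has taken place: a message
-- lost on the lossy channel only blocks the run. For both families of tests this
-- is possible because each letter x of the queue is sent as ★ x, so that parity,
-- and also the head, tells whether a ★ has just been read.
--
-- Given a Turing machine T, a queue automaton of this kind is built that produces
-- the code of the very instance that simulates it, runs T on this code, and halts
-- iff T rejects. To refer to itself, the instance starts with a chain of rules
-- that writes a word d on the reliable channel; d is the code of the remaining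
-- rules, from which the automaton can compute the code of the chain as well.
-- Since the automaton is deterministic, an accepting run of T excludes its halting,
-- so T does not decide the instance correctly.

module Submission where

open import Defs
open import Data.Bool.Base using (Bool; true; false)
open import Data.Empty using (⊥; ⊥-elim)
open import Data.Fin.Base using (Fin; zero; suc; toℕ; _↑ʳ_; fromℕ<)
open import Data.Fin.Properties using (toℕ-↑ʳ; ↑ʳ-injective; toℕ-fromℕ<)
open import Data.List.Base as List
  using (List; []; _∷_; _++_; [_]; map; concatMap; length; lookup; allFin;
         cartesianProduct; cartesianProductWith; replicate; reverse; drop)
open import Data.List.Membership.Propositional using (_∈_)
open import Data.List.Membership.Propositional.Properties
  using (∈-map⁺; ∈-map⁻; ∈-++⁺ˡ; ∈-++⁺ʳ; ∈-++⁻; ∈-concatMap⁺; ∈-concatMap⁻;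
         ∈-cartesianProduct⁺; ∈-lookup; ∈-allFin; ∈-cartesianProductWith⁺)
open import Data.List.Properties
  using (length-++-≤ʳ; ++-assoc; ++-identityʳ; ∷-injectiveˡ; ∷-injectiveʳ; ++-monoid;
         length-map; map-++; concatMap-++; map-concatMap; length-++; unfold-reverse;
         map-∘)
open import Data.List.Relation.Binary.Pointwise.Base using ([]; _∷_)
open import Data.List.Relation.Ternary.Appending.Propositional as Appending using ()
open import Data.List.Relation.Unary.All as All using (All; []; _∷_)
open import Data.List.Relation.Unary.All.Properties as AllP using ()
open import Data.List.Relation.Unary.Any as Any using (here; there; index)
open import Data.List.Relation.Unary.Any.Properties using (lookup-index)
open import Data.Maybe.Base using (Maybe; just; nothing; fromMaybe)
open import Data.Nat.Base using (ℕ; zero; suc; _+_; _*_; _<_; s≤s)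
open import Data.Nat.Properties
  using (even≢odd; *-suc; m≤m+n; <-trans; n<1+n; <-irrefl; ≤-trans; ≤-reflexive;
         +-comm; +-identityʳ)
open import Data.Product.Base using (_×_; _,_; ∃-syntax; proj₁; proj₂; ∃₂; uncurry)
open import Data.Sum.Base using (inj₁; inj₂)
open import Data.Unit.Base using (tt)
open import Function.Base using (_∘_; id)
open import Relation.Binary.Construct.Closure.ReflexiveTransitive using (Star; ε; _◅_; _◅◅_)
open import Relation.Binary.PropositionalEquality
  using (_≡_; _≢_; refl; sym; trans; cong; cong₂; subst; module ≡-Reasoning)
open import Relation.Nullary.Negation.Core using (¬_)
open import Tactic.MonoidSolver using (solve)

-- Finite types, framed words, and what is asked of a family of tests

record Finite (A : Set) : Set where
  field
    elements : List A
    complete : ∀ x → x ∈ elements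

  size : ℕ
  size = length elements

  code : A → Fin size
  code = index ∘ complete

  code-injective : ∀ {x y} → code x ≡ code y → x ≡ y
  code-injective {x} {y} eq = trans (lookup-index (complete x))
    (trans (cong (lookup elements) eq) (sym (lookup-index (complete y))))

module Framing {A : Set} (finite : Finite A) where
  open Finite finite

  #msgs : ℕ
  #msgs = suc size

  ★ : Fin #msgs
  ★ = zero

  letter : A → Fin #msgs
  letter x = suc (code x)

  letter-injective : ∀ {x y} → letter x ≡ letter y → x ≡ y
  letter-injective eq = code-injective (suc-inj eq)
    where
    suc-inj : ∀ {n} {i j : Fin n} → suc i ≡ suc j → i ≡ j
    suc-inj refl = refl

  frames : List A → List (Fin #msgs)
  frames []       = []
  frames (x ∷ xs) = ★ ∷ letter x ∷ frames xs

  frames-++ : ∀ xs ys → frames (xs ++ ys) ≡ frames xs ++ frames ys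
  frames-++ []       ys = refl
  frames-++ (x ∷ xs) ys = cong (λ z → ★ ∷ letter x ∷ z) (frames-++ xs ys)

  length-frames : ∀ xs → length (frames xs) ≡ length xs * 2
  length-frames []       = refl
  length-frames (x ∷ xs) = cong (2 +_) (length-frames xs)

-- `half x` is meant for the moment when the ★ of the first frame has been read, `full` for the
-- moment when its letter has been read too. Each fails on the content before that read, so passing
-- it certifies the read. `full` is asked to hold on nonempty words only, since a head test rejects
-- the empty word.
record Tests (𝒯 : {m : ℕ} → Reg m → Set) {A : Set} (finite : Finite A) : Set where
  open Framing finite
  field
    full       : Reg #msgs
    half       : A → Reg #msgs
    full-ok    : 𝒯 full
    half-ok    : ∀ x → 𝒯 (half x)
    full-holds : ∀ x xs → Language full (frames (x ∷ xs))
    half-holds : ∀ x xs → Language (half x) (letter x ∷ frames xs)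
    full-fails : ∀ x xs → ¬ Language full (letter x ∷ frames xs)
    half-fails : ∀ x xs → ¬ Language (half x) (frames xs)

-- Parity tests and head tests on framed words

module _ {m : ℕ} where

  any-holds : (a : Fin m) → Language anyLetter [ a ]
  any-holds a = RE.[^ [] ]

  even-[] : Language {m} even []
  even-[] = RE.star (RE.sum (inj₁ RE.ε))

  even-∷∷ : ∀ {w} (a b : Fin m) → Language even w → Language even (a ∷ b ∷ w)
  even-∷∷ a b p = RE.star (RE.sum (inj₂
    (RE.prod ((a ∷ b ∷ []) Appending.++ _)
      (RE.prod ([ a ] Appending.++ [ b ]) (any-holds a) (any-holds b)) p)))

  odd-∷ : ∀ {w} (a : Fin m) → Language even w → Language odd (a ∷ w)
  odd-∷ a p = RE.prod ([ a ] Appending.++ _) (any-holds a) p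

  even-length : ∀ {w} → Language {m} even w → ∃[ k ] length w ≡ 2 * k
  even-length (RE.star (RE.sum (inj₁ RE.ε))) = 0 , refl
  even-length (RE.star (RE.sum (inj₂ (RE.prod app (RE.prod app′ RE.[^ _ ] RE.[^ _ ]) p))))
    with refl ← Appending.break app′ | refl ← Appending.break app | k , eq ← even-length p
    = suc k , trans (cong (2 +_) eq) (sym (*-suc 2 k))

  odd-length : ∀ {w} → Language {m} odd w → ∃[ k ] length w ≡ suc (2 * k)
  odd-length (RE.prod app RE.[^ _ ] p)
    with refl ← Appending.break app | k , eq ← even-length p = k , cong suc eq

  any⋆-holds : (w : List (Fin m)) → Language (anyLetter RE.⋆) w
  any⋆-holds []      = RE.star (RE.sum (inj₁ RE.ε))
  any⋆-holds (a ∷ w) = RE.star (RE.sum (inj₂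
    (RE.prod ([ a ] Appending.++ w) (any-holds a) (any⋆-holds w))))

  head-holds : (a : Fin m) (w : List (Fin m)) → Language (head a) (a ∷ w)
  head-holds a w = RE.prod ([ a ] Appending.++ w) RE.[ here RE.[ refl ] ] (any⋆-holds w)

  head-fails-[] : {a : Fin m} → ¬ Language (head a) []
  head-fails-[] (RE.prod () RE.[ _ ] p)

  head-∷ : ∀ {a b : Fin m} {w} → Language (head a) (b ∷ w) → b ≡ a
  head-∷ (RE.prod app RE.[ here RE.[ eq ] ] p) with refl ← Appending.break app = eq

module _ {A : Set} (finite : Finite A) where
  open Framing finite

  frames-even : ∀ xs → Language even (frames xs)
  frames-even []       = even-[]
  frames-even (x ∷ xs) = even-∷∷ ★ (letter x) (frames-even xs)

  even≁odd : {w : List (Fin #msgs)} → Language even w → Language odd w → ⊥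
  even≁odd p q with j , eq ← even-length p | k , eq′ ← odd-length q
    = even≢odd j k (trans (sym eq) eq′)

  parity-tests : Tests IsParityTest finite
  parity-tests = record
    { full       = even
    ; half       = λ _ → odd
    ; full-ok    = inj₁ (id , id)
    ; half-ok    = λ _ → inj₂ (id , id)
    ; full-holds = λ x xs → frames-even (x ∷ xs)
    ; half-holds = λ x xs → odd-∷ (letter x) (frames-even xs)
    ; full-fails = λ x xs p → even≁odd p (odd-∷ (letter x) (frames-even xs))
    ; half-fails = λ x xs → even≁odd (frames-even xs)
    }

  head-tests : Tests IsHeadTest finite
  head-tests = record
    { full       = head ★
    ; half       = head ∘ letter
    ; full-ok    = ★ , id , id
    ; half-ok    = λ x → letter x , id , id
    ; full-holds = λ x xs → head-holds ★ (letter x ∷ frames xs)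
    ; half-holds = λ x xs → head-holds (letter x) (frames xs)
    ; full-fails = λ x xs p → case (head-∷ p)
    ; half-fails = fails
    }
    where
    case : ∀ {x} → letter x ≡ ★ → ⊥
    case ()
    fails : ∀ x xs → ¬ Language (head (letter x)) (frames xs)
    fails x []      p = head-fails-[] p
    fails x (_ ∷ _) p with () ← head-∷ p

-- Queue automata

module Queue {A S : Set} (δ : S → A → List A × Maybe S) where

  QConfig : Set
  QConfig = Maybe S × List A

  infix 4 _⇒_ _⇉_

  data _⇒_ : QConfig → QConfig → Set where
    step : ∀ {s x w t u} → δ s x ≡ (w , t) → (just s , x ∷ u) ⇒ (t , u ++ w)

  -- Head tests cannot recognise an empty channel, so the simulation of a step
  -- must not empty the queue on the way.

  data _⇉_ : QConfig → QConfig → Set where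
    step : ∀ {s x w t u} → δ s x ≡ (w , t) → u ≢ [] → (just s , x ∷ u) ⇉ (t , u ++ w)

-- Receiver: obeying commands

module Receiver {A : Set} (finiteA : Finite A) where

  open Framing finiteA

  #receiver : ℕ
  #receiver = suc #msgs

  idle : Fin #receiver
  idle = zero

  pairRules : Fin #msgs → List (Rule #msgs #receiver)
  pairRules a = rule idle l (msg a) (suc a) ∷ rule (suc a) r (msg a) idle ∷ []

  data ReceiverRule : Fin #receiver → Channel → Act #msgs → Fin #receiver → Set where
    take    : ∀ a → ReceiverRule idle l (msg a) (suc a)
    consume : ∀ a → ReceiverRule (suc a) r (msg a) idle

  opaque

    receiverRules : List (Rule #msgs #receiver)
    receiverRules = concatMap pairRules (allFin #msgs)

    receiverRules-sound : ∀ {q c α q′} → rule q c α q′ ∈ receiverRules → ReceiverRule q c α q′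
    receiverRules-sound ρ∈ with Any.satisfied (∈-concatMap⁻ pairRules {xs = allFin #msgs} ρ∈)
    ... | a , here refl         = take a
    ... | a , there (here refl) = consume a

    receiverRules-∋ : ∀ a {ρ} → ρ ∈ pairRules a → ρ ∈ receiverRules
    receiverRules-∋ a ρ∈ = ∈-concatMap⁺ pairRules (Any.map (λ { refl → ρ∈ }) (∈-allFin a))

-- Sender: the control of a queue automaton as a finite graph

module Relay (𝒯 : {m : ℕ} → Reg m → Set) {A S : Set}
  (finiteA : Finite A) (tests : Tests 𝒯 finiteA) (finiteS : Finite S)
  (δ : S → A → List A × Maybe S) where

  open Framing finiteA
  open Receiver finiteA
  open Tests tests
  open Queue δ

  Action : Set
  Action = Channel × Act #msgs

  send : Fin #msgs → Action
  send a = r , msg a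

  -- The actions still to be performed, and the state of the queue automaton
  -- to be entered afterwards.

  Node : Set
  Node = List Action × Maybe S

  -- One step of the automaton gives two commands on the lossy channel, one for each half of the
  -- front frame, and waits after each at a test that fails until Receiver has obeyed. Each list is
  -- the tail of the one that precedes it in time, so that `act` leads from phase to phase.
  read₁ read₂ read₃ body : S → A → Node
  read₃ s x = (r , test full) ∷ map send (frames (proj₁ (δ s x))) , proj₂ (δ s x)
  read₂ s x = (l , msg (letter x)) ∷ proj₁ (read₃ s x) , proj₂ (δ s x)
  read₁ s x = (r , test (half x)) ∷ proj₁ (read₂ s x) , proj₂ (δ s x)
  body  s x = (l , msg ★) ∷ proj₁ (read₁ s x) , proj₂ (δ s x)

  -- With `choose`, Sender guesses the letter at the front of the queue, which it cannot read; a
  -- wrong guess blocks the run later. With `flush`, a Sender that has halted commands Receiver to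
  -- empty the reliable channel, because the run asked for must end with empty channels.
  data Edge : Node → Action → Node → Set where
    act    : ∀ {a as t} → Edge (a ∷ as , t) a (as , t)
    choose : ∀ {s} x → Edge ([] , just s) (r , ε) (body s x)
    flush  : ∀ a → Edge ([] , nothing) (l , msg a) ([] , nothing)

  suffixes : List Action → Maybe S → List Node
  suffixes []       t = []
  suffixes (a ∷ as) t = (a ∷ as , t) ∷ suffixes as t

  suffixes-closed : ∀ bs {t t′ a b as} →
    (a ∷ b ∷ as , t) ∈ suffixes bs t′ → (b ∷ as , t) ∈ suffixes bs t′
  suffixes-closed (_ ∷ _ ∷ _) (here refl) = there (here refl)
  suffixes-closed (_ ∷ bs)    (there n∈)  = there (suffixes-closed bs n∈)

  bodySuffixes : S × A → List Node
  bodySuffixes (s , x) = uncurry suffixes (body s x)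

  private
    states  = Finite.elements finiteS
    letters = Finite.elements finiteA

  stateLetters : List (S × A)
  stateLetters = cartesianProduct states letters

  restNodes : List Node
  restNodes = map ([] ,_) (nothing ∷ map just states)

  opaque

    nodes : List Node
    nodes = restNodes ++ concatMap bodySuffixes stateLetters

    resting∈ : ∀ t → ([] , t) ∈ nodes
    resting∈ nothing  = here refl
    resting∈ (just s) = there (∈-++⁺ˡ (∈-map⁺ _ (∈-map⁺ just (Finite.complete finiteS s))))

    ∉restNodes : ∀ {a as t} → ¬ (a ∷ as , t) ∈ restNodes
    ∉restNodes n∈ with _ , _ , () ← ∈-map⁻ _ n∈

    tail∈ : ∀ {a as t} → (a ∷ as , t) ∈ nodes → (as , t) ∈ nodes
    tail∈ {as = []}     {t} _  = resting∈ t
    tail∈ {as = b ∷ as} {t} n∈ with ∈-++⁻ restNodes n∈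
    ... | inj₁ n∈′ = ⊥-elim (∉restNodes n∈′)
    ... | inj₂ n∈′ = ∈-++⁺ʳ restNodes (∈-concatMap⁺ bodySuffixes
      (Any.map (suffixes-closed _) (∈-concatMap⁻ bodySuffixes {xs = stateLetters} n∈′)))

    body∈ : ∀ s x → body s x ∈ nodes
    body∈ s x = ∈-++⁺ʳ restNodes (∈-concatMap⁺ bodySuffixes
      (Any.map (λ { refl → here refl })
        (∈-cartesianProduct⁺ (Finite.complete finiteS s) (Finite.complete finiteA x))))

  #nodes : ℕ
  #nodes = length nodes

  node : Fin #nodes → Node
  node = lookup nodes

  position : ∀ {n} → n ∈ nodes → Fin #nodes
  position = index

  node-position : ∀ {n} (n∈ : n ∈ nodes) → node (position n∈) ≡ n
  node-position n∈ = sym (lookup-index n∈)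

  final : Fin #nodes
  final = position (resting∈ nothing)

  node-final : node final ≡ ([] , nothing)
  node-final = node-position (resting∈ nothing)

  -- The node is an argument of its own, beside its position `i`, because `node i` is a lookup that
  -- cannot be matched on.
  outgoing : Fin #nodes → ∀ n → n ∈ nodes → List (Rule #msgs #nodes)
  outgoing i ((c , α) ∷ as , t) n∈ = [ rule i c α (position (tail∈ n∈)) ]
  outgoing i ([] , just s)      _  = map (λ x → rule i r ε (position (body∈ s x))) letters
  outgoing i ([] , nothing)     _  = map (λ a → rule i l (msg a) final) (allFin #msgs)

  outgoingAt : Fin #nodes → List (Rule #msgs #nodes)
  outgoingAt i = outgoing i (node i) (∈-lookup i)

  outgoing-sound : ∀ {i n p c α p′} (n∈ : n ∈ nodes) →
    rule p c α p′ ∈ outgoing i n n∈ → p ≡ i × Edge n (c , α) (node p′)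
  outgoing-sound {n = _ ∷ _ , _} n∈ (here refl) =
    refl , subst (Edge _ _) (sym (node-position (tail∈ n∈))) act
  outgoing-sound {n = [] , just s} _ ρ∈ with x , _ , refl ← ∈-map⁻ _ ρ∈ =
    refl , subst (Edge _ _) (sym (node-position (body∈ s x))) (choose x)
  outgoing-sound {n = [] , nothing} _ ρ∈ with a , _ , refl ← ∈-map⁻ _ ρ∈ =
    refl , subst (Edge _ _) (sym node-final) (flush a)

  -- A node can occur several times in `nodes`, for instance when two bodies share a suffix, and a
  -- rule leads to one of its positions. Hence the target is described by its node and not by its
  -- position.
  outgoing-complete : ∀ {i n c α n′} (n∈ : n ∈ nodes) → Edge n (c , α) n′ →
    ∃[ p′ ] node p′ ≡ n′ × rule i c α p′ ∈ outgoing i n n∈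
  outgoing-complete n∈ act = _ , node-position (tail∈ n∈) , here refl
  outgoing-complete n∈ (choose {s} x) =
    _ , node-position (body∈ s x) , ∈-map⁺ _ (Finite.complete finiteA x)
  outgoing-complete n∈ (flush a) = final , node-final , ∈-map⁺ _ (∈-allFin a)

  opaque

    nodeRules : List (Rule #msgs #nodes)
    nodeRules = concatMap outgoingAt (allFin #nodes)

    nodeRules-sound : ∀ {p c α p′} → rule p c α p′ ∈ nodeRules → Edge (node p) (c , α) (node p′)
    nodeRules-sound ρ∈ with Any.satisfied (∈-concatMap⁻ outgoingAt {xs = allFin #nodes} ρ∈)
    ... | i , ρ∈′ with refl , e ← outgoing-sound (∈-lookup i) ρ∈′ = e

    nodeRules-∋ : ∀ {i ρ} → ρ ∈ outgoingAt i → ρ ∈ nodeRules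
    nodeRules-∋ {i} ρ∈ = ∈-concatMap⁺ outgoingAt (Any.map (λ { refl → ρ∈ }) (∈-allFin i))

  nodeRules-complete : ∀ {i c α n′} → Edge (node i) (c , α) n′ →
    ∃[ p′ ] node p′ ≡ n′ × rule i c α p′ ∈ nodeRules
  nodeRules-complete {i} e =
    let p′ , eq , ρ∈ = outgoing-complete (∈-lookup i) e in p′ , eq , nodeRules-∋ {i} ρ∈

  data Allowed : Action → Set where
    msg  : ∀ {c a} → Allowed (c , msg a)
    test : ∀ {R} → 𝒯 R → Allowed (r , test R)

  AllowedNode : Node → Set
  AllowedNode (as , _) = All Allowed as

  suffixes-ok : ∀ {as t} → All Allowed as → All AllowedNode (suffixes as t)
  suffixes-ok []       = []
  suffixes-ok (p ∷ ps) = (p ∷ ps) ∷ suffixes-ok ps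

  body-ok : ∀ s x → AllowedNode (body s x)
  body-ok s x = msg ∷ test (half-ok x) ∷ msg ∷ test full-ok ∷
    AllP.map⁺ (All.universal (λ _ → msg) (frames (proj₁ (δ s x))))

  opaque
    unfolding nodes

    nodes-ok : All AllowedNode nodes
    nodes-ok = AllP.++⁺ (AllP.map⁺ (All.universal (λ _ → []) _))
      (AllP.concat⁺ (AllP.map⁺ (All.universal (λ (s , x) → suffixes-ok (body-ok s x)) stateLetters)))

  edge-ok : ∀ {n c α n′ k} {p p′ : Fin k} → AllowedNode n → Edge n (c , α) n′ →
    SenderRuleOK 𝒯 (rule p c α p′)
  edge-ok (msg {r} ∷ _)  act        = tt
  edge-ok (msg {l} ∷ _)  act        = tt
  edge-ok (test ok ∷ _)  act        = ok
  edge-ok _              (choose _) = tt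
  edge-ok _              (flush _)  = tt

  -- The system that loads a word and then simulates the automaton

  module System (start : S) (input : List A) where

    feed : List (Fin #msgs)
    feed = frames input

    ℓ : ℕ
    ℓ = length feed

    -- Sender first descends through the states ℓ, …, 1, 0 while writing feed.

    #sender : ℕ
    #sender = suc ℓ + #nodes

    at : Fin #nodes → Fin #sender
    at = suc ℓ ↑ʳ_

    shift : Rule #msgs #nodes → Rule #msgs #sender
    shift (rule i c α j) = rule (at i) c α (at j)

    entryPoint : Fin #nodes
    entryPoint = position (resting∈ (just start))

    entry : Rule #msgs #sender
    entry = rule zero r ε (at entryPoint)

    -- The state is the number of messages still to be written, so a rule depends only on the suffix
    -- of `feed` that it starts. This is what allows the automaton to compute the code of the chain
    -- letter by letter.
    loadRules : ∀ z → length z < #sender → List (Rule #msgs #sender)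
    loadRules []      _   = []
    loadRules (a ∷ z) z<N =
      rule (fromℕ< z<N) r (msg a) (fromℕ< (<-trans (n<1+n _) z<N)) ∷
      loadRules z (<-trans (n<1+n _) z<N)

    ℓ<#sender : ℓ < #sender
    ℓ<#sender = s≤s (m≤m+n ℓ #nodes)

    -- The chain stands last, so that the code of the instance is a fixed part, then the codes of
    -- the chain, then the code of Receiver.
    senderRules : List (Rule #msgs #sender)
    senderRules = entry ∷ map shift nodeRules ++ loadRules feed ℓ<#sender

    system : UCST
    system = ucst #msgs #sender #receiver senderRules receiverRules

    problem : Instance
    problem = inst system (fromℕ< ℓ<#sender) (at final) idle idle

    open Semantics system

    data SenderRule (p : Fin #sender) : Channel → Act #msgs → Fin #sender → Set where
      enter  : toℕ p ≡ 0 → SenderRule p r ε (at entryPoint)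
      follow : ∀ {i c α j} → p ≡ at i → Edge (node i) (c , α) (node j) →
               SenderRule p c α (at j)
      load   : ∀ {y a z p′} → y ++ a ∷ z ≡ feed → toℕ p ≡ suc (length z) →
               toℕ p′ ≡ length z → SenderRule p r (msg a) p′

    loadRules-sound : ∀ {y z p c α p′} (z<N : length z < #sender) → y ++ z ≡ feed →
      rule p c α p′ ∈ loadRules z z<N → SenderRule p c α p′
    loadRules-sound {z = a ∷ z} z<N eq (here refl) =
      load eq (toℕ-fromℕ< z<N) (toℕ-fromℕ< _)
    loadRules-sound {y} {a ∷ z} z<N eq (there ρ∈) =
      loadRules-sound {y ++ [ a ]} _ (trans (++-assoc y [ a ] z) eq) ρ∈

    senderRules-sound : ∀ {p c α p′} → rule p c α p′ ∈ senderRules → SenderRule p c α p′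
    senderRules-sound (here refl) = enter refl
    senderRules-sound (there ρ∈) with ∈-++⁻ (map shift nodeRules) ρ∈
    ... | inj₂ ρ∈′ = loadRules-sound {[]} ℓ<#sender refl ρ∈′
    ... | inj₁ ρ∈′ with rule i c α j , i∈ , refl ← ∈-map⁻ shift ρ∈′ =
      follow refl (nodeRules-sound i∈)

    -- From runs of the system to runs of the queue automaton

    Reach : QConfig → Set
    Reach = Star _⇒_ (just start , input)

    -- The command a has been written on the lossy channel while the reliable
    -- channel contained u₀.

    data Transit (a : Fin #msgs) (u₀ : Word) : Fin #receiver → Word → Word → Set where
      sent     : Transit a u₀ idle u₀ [ a ]
      lost     : Transit a u₀ idle u₀ []
      received : Transit a u₀ (suc a) u₀ []
      done     : ∀ {u} → u₀ ≡ a ∷ u → Transit a u₀ idle u []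

    -- A configuration records the state and queue last reached by the automaton and how far the
    -- next step has got. The letter `x` remains a guess until `read-frame`. In `halted` the
    -- channels are arbitrary: flushing commands may be pending or lost, and only the halting run of
    -- the automaton has to be remembered.
    data Active : Node → Fin #receiver → Word → Word → Set where
      ready   : ∀ {s x w} → Reach (just s , w) → Active (body s x) idle (frames w) []
      asked   : ∀ {s x w q u v} → Reach (just s , w) → Transit ★ (frames w) q u v →
                Active (read₁ s x) q u v
      checked : ∀ {s x w u} → Reach (just s , w) → frames w ≡ ★ ∷ u →
                Active (read₂ s x) idle u []
      named   : ∀ {s x w u₀ q u v} → Reach (just s , w) → frames w ≡ ★ ∷ u₀ →
                Transit (letter x) u₀ q u v → Active (read₃ s x) q u v
      writing : ∀ {t w u} z → Reach (t , w) → u ++ z ≡ frames w →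
                Active (map send z , t) idle u []
      halted  : ∀ {w q u v} → Reach (nothing , w) → Active ([] , nothing) q u v

    -- The empty lossy channel of `loading` is stated by an equation, so that a loss step, whose
    -- source contains a concatenation, can be matched.
    data Inv : Config → Set where
      loading : ∀ {p u v z} → toℕ p ≡ length z → u ++ z ≡ feed → v ≡ [] →
                Inv (config p idle u v)
      running : ∀ {p i n q u v} → p ≡ at i → node i ≡ n → Active n q u v →
                Inv (config p q u v)

    -- Here the guess turns out to be right: Receiver could remove the named letter only because it
    -- was at the front, and `letter` is injective.
    read-frame : ∀ {w x u₀ u} → frames w ≡ ★ ∷ u₀ → u₀ ≡ letter x ∷ u →
      ∃[ w′ ] w ≡ x ∷ w′ × u ≡ frames w′
    read-frame {y ∷ w} refl eq =
      w , cong (_∷ w) (letter-injective (∷-injectiveˡ eq)) , sym (∷-injectiveʳ eq)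

    full-fails′ : ∀ {w u} → frames w ≡ ★ ∷ u → ¬ Language full u
    full-fails′ {y ∷ w} refl = full-fails y w

    -- In every `Transit` state but `done` the reliable channel is what it was when the command was
    -- written, and the test rejects that content. So a passed test leaves `done` as the only case.
    active-r : ∀ {n q u u′ v α n′} → Active n q u v → Edge n (r , α) n′ →
      SenderEffect α u u′ → Active n′ q u′ v
    active-r (asked {x = x} {w} ρ sent)     act (test p) = ⊥-elim (half-fails x w p)
    active-r (asked {x = x} {w} ρ lost)     act (test p) = ⊥-elim (half-fails x w p)
    active-r (asked {x = x} {w} ρ received) act (test p) = ⊥-elim (half-fails x w p)
    active-r (asked ρ (done eq))            act (test _) = checked ρ eq
    active-r (named ρ eq sent)              act (test p) = ⊥-elim (full-fails′ eq p)
    active-r (named ρ eq lost)              act (test p) = ⊥-elim (full-fails′ eq p)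
    active-r (named ρ eq received)          act (test p) = ⊥-elim (full-fails′ eq p)
    active-r (named {s} {x} ρ eq (done eq′)) act (test _)
      with w , refl , refl ← read-frame eq eq′
      = writing (frames y) (ρ ◅◅ step refl ◅ ε) (sym (frames-++ w y))
      where y = proj₁ (δ s x)
    active-r (writing (a ∷ z) ρ eq) act write = writing z ρ (trans (++-assoc _ [ a ] z) eq)
    active-r (writing [] ρ eq) (choose x) ε =
      subst (λ u → Active _ idle u []) (trans (sym eq) (++-identityʳ _)) (ready ρ)

    active-l : ∀ {n q u v v′ α n′} → Active n q u v → Edge n (l , α) n′ →
      SenderEffect α v v′ → Active n′ q u v′
    active-l (ready ρ)        act       write = asked ρ sent
    active-l (checked ρ eq)   act       write = named ρ eq sent
    active-l (writing [] ρ _) (flush _) write = halted ρ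
    active-l (halted ρ)       (flush _) write = halted ρ

    transit-r : ∀ {a u₀ q u u′ v α q′} → Transit a u₀ q u v → ReceiverRule q r α q′ →
      ReceiverEffect α u u′ → Transit a u₀ q′ u′ v
    transit-r received (consume _) read = done refl

    transit-l : ∀ {a u₀ q u v v′ α q′} → Transit a u₀ q u v → ReceiverRule q l α q′ →
      ReceiverEffect α v v′ → Transit a u₀ q′ u v′
    transit-l sent (take _) read = received

    transit-loss : ∀ {a u₀ q u v} v₁ {x v₂} → Transit a u₀ q u v → v ≡ v₁ ++ x ∷ v₂ →
      Transit a u₀ q u (v₁ ++ v₂)
    transit-loss []          sent refl = lost
    transit-loss (_ ∷ [])    sent ()
    transit-loss (_ ∷ _ ∷ _) sent ()
    transit-loss []      lost     ()
    transit-loss (_ ∷ _) lost     ()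
    transit-loss []      received ()
    transit-loss (_ ∷ _) received ()
    transit-loss []      (done _) ()
    transit-loss (_ ∷ _) (done _) ()

    receiver-r : ∀ {n q u u′ v α q′} → Active n q u v → ReceiverRule q r α q′ →
      ReceiverEffect α u u′ → Active n q′ u′ v
    receiver-r (asked ρ τ)    ρ∈ e = asked ρ (transit-r τ ρ∈ e)
    receiver-r (named ρ eq τ) ρ∈ e = named ρ eq (transit-r τ ρ∈ e)
    receiver-r (halted ρ)     _  _ = halted ρ

    receiver-l : ∀ {n q u v v′ α q′} → Active n q u v → ReceiverRule q l α q′ →
      ReceiverEffect α v v′ → Active n q′ u v′
    receiver-l (asked ρ τ)    ρ∈ e = asked ρ (transit-l τ ρ∈ e)
    receiver-l (named ρ eq τ) ρ∈ e = named ρ eq (transit-l τ ρ∈ e)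
    receiver-l (halted ρ)     _  _ = halted ρ
    receiver-l (ready _)       (take _) ()
    receiver-l (checked _ _)   (take _) ()
    receiver-l (writing _ _ _) (take _) ()

    []≢insert : ∀ {x v₂} (v₁ : Word) → [] ≢ v₁ ++ x ∷ v₂
    []≢insert []      ()
    []≢insert (_ ∷ _) ()

    active-loss : ∀ {n q u v} v₁ {x v₂} → Active n q u v → v ≡ v₁ ++ x ∷ v₂ →
      Active n q u (v₁ ++ v₂)
    active-loss v₁ (asked ρ τ)     eq = asked ρ (transit-loss v₁ τ eq)
    active-loss v₁ (named ρ eq′ τ) eq = named ρ eq′ (transit-loss v₁ τ eq)
    active-loss v₁ (halted ρ)      eq = halted ρ
    active-loss v₁ (ready _)       eq = ⊥-elim ([]≢insert v₁ eq)
    active-loss v₁ (checked _ _)   eq = ⊥-elim ([]≢insert v₁ eq)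
    active-loss v₁ (writing _ _ _) eq = ⊥-elim ([]≢insert v₁ eq)

    ++-injectiveʳ : ∀ {B : Set} (xs xs′ : List B) {ys ys′} → length ys ≡ length ys′ →
      xs ++ ys ≡ xs′ ++ ys′ → ys ≡ ys′
    ++-injectiveʳ []       []         _  eq = eq
    ++-injectiveʳ (_ ∷ xs) (_ ∷ xs′)  ≡ℓ eq = ++-injectiveʳ xs xs′ ≡ℓ (∷-injectiveʳ eq)
    ++-injectiveʳ []       (x ∷ xs′) {ys′ = ys′} ≡ℓ refl =
      ⊥-elim (<-irrefl (sym ≡ℓ) (s≤s (length-++-≤ʳ ys′ {xs′})))
    ++-injectiveʳ (x ∷ xs) []        {ys}        ≡ℓ refl =
      ⊥-elim (<-irrefl ≡ℓ (s≤s (length-++-≤ʳ ys {xs})))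

    -- The states `at i` lie above `ℓ`, whereas the length of a suffix of `feed` is at most `ℓ`.
    not-loading : ∀ {p i} u {z} → p ≡ at i → toℕ p ≡ length z → ¬ (u ++ z ≡ feed)
    not-loading {i = i} u {z} refl p≡ eq = <-irrefl refl
      (≤-trans (s≤s (≤-trans (length-++-≤ʳ z {u}) (≤-reflexive (cong length eq))))
      (≤-trans (m≤m+n (suc ℓ) (toℕ i)) (≤-reflexive (trans (sym (toℕ-↑ʳ (suc ℓ) i)) p≡))))

    loading-step : ∀ {p u z c α p′} → toℕ p ≡ length z → u ++ z ≡ feed → SenderRule p c α p′ →
      (c ≡ r × ∀ {u′} → SenderEffect α u u′ → Inv (config p′ idle u′ []))
    loading-step {u = u} {[]} p≡ eq (enter _) =
      refl , λ { ε → running refl (node-position (resting∈ (just start))) (writing [] ε eq) }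
    loading-step {z = _ ∷ _} p≡ eq (enter p≡0) with () ← trans (sym p≡) p≡0
    loading-step {u = u} p≡ eq (follow p≡′ _) = ⊥-elim (not-loading u p≡′ p≡ eq)
    loading-step {u = u} {z} p≡ eq (load {y} {a} {z′} eq′ p≡′ p′≡)
      -- Two suffixes of `feed` of the same length are equal, so the state determines which message
      -- the chain writes next.
      with refl ← ++-injectiveʳ u y {z} {a ∷ z′} (trans (sym p≡) p≡′) (trans eq (sym eq′))
      = refl , λ { write → loading p′≡ (trans (++-assoc u [ a ] z′) eq) refl }

    running-edge : ∀ {p i c α p′} → p ≡ at i → SenderRule p c α p′ →
      ∃[ j ] p′ ≡ at j × Edge (node i) (c , α) (node j)
    running-edge {i = i} refl (follow {i′} p≡ e)
      with refl ← ↑ʳ-injective (suc ℓ) i i′ p≡ = _ , refl , e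
    running-edge refl (load {y} eq p≡ _) = ⊥-elim (not-loading y refl p≡ eq)

    preserve : ∀ {C D} → Inv C → C ⟶ D → Inv D
    preserve (loading {u = u} p≡ eq v≡) (senderR ρ∈ e) with refl ← v≡ =
      proj₂ (loading-step {u = u} p≡ eq (senderRules-sound ρ∈)) e
    preserve (loading {u = u} p≡ eq v≡) (senderL ρ∈ e)
      with () ← proj₁ (loading-step {u = u} p≡ eq (senderRules-sound ρ∈))
    preserve (running p≡ refl a) (senderR ρ∈ e) with running-edge p≡ (senderRules-sound ρ∈)
    ... | _ , p′≡ , edge = running p′≡ refl (active-r a edge e)
    preserve (running p≡ refl a) (senderL ρ∈ e) with running-edge p≡ (senderRules-sound ρ∈)
    ... | _ , p′≡ , edge = running p′≡ refl (active-l a edge e)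
    preserve (loading p≡ eq v≡) (receiverR ρ∈ e) with () ← receiverRules-sound ρ∈
    preserve (running p≡ n≡ a) (receiverR ρ∈ e) =
      running p≡ n≡ (receiver-r a (receiverRules-sound ρ∈) e)
    preserve (loading p≡ eq v≡) (receiverL ρ∈ e) with receiverRules-sound ρ∈ | v≡ | e
    ... | take _ | refl | ()
    preserve (running p≡ n≡ a) (receiverL ρ∈ e) =
      running p≡ n≡ (receiver-l a (receiverRules-sound ρ∈) e)
    preserve (loading p≡ eq v≡) (loss v₁ _ _) = ⊥-elim ([]≢insert v₁ (sym v≡))
    preserve (running p≡ n≡ a)  (loss v₁ _ _) = running p≡ n≡ (active-loss v₁ a refl)

    Halts : Set
    Halts = ∃[ w ] Reach (nothing , w)

    active-halts : ∀ {n q u v} → Active n q u v → n ≡ ([] , nothing) → Halts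
    active-halts (writing [] ρ _) refl = _ , ρ
    active-halts (halted ρ)       refl = _ , ρ

    inv-halts : ∀ {q u v} → Inv (config (at final) q u v) → Halts
    inv-halts (loading {u = u} p≡ eq _) = ⊥-elim (not-loading u refl p≡ eq)
    inv-halts (running {i = i} p≡ refl a)
      with refl ← ↑ʳ-injective (suc ℓ) final i p≡ = active-halts a node-final

    preserve* : ∀ {C D} → Inv C → C ⟶* D → Inv D
    preserve* I ε        = I
    preserve* I (s ◅ ss) = preserve* (preserve I s) ss

    reachable⇒halts : E-E-Reach problem → Halts
    reachable⇒halts ρ = inv-halts (preserve* (loading (toℕ-fromℕ< ℓ<#sender) refl refl) ρ)

    -- From runs of the queue automaton to runs of the system

    data Local : Set where
      local : Node → Fin #receiver → Word → Word → Local

    _at⟨_⟩ : Local → Fin #nodes → Config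
    local _ q u v at⟨ i ⟩ = config (at i) q u v

    nodeOf : Local → Node
    nodeOf (local n _ _ _) = n

    infix 4 _⇝_

    -- From every position of the first node, some position of the second is reached. This asymmetry
    -- is what makes the relation compose, given that rules lead to particular positions.
    _⇝_ : Local → Local → Set
    X ⇝ Y = ∀ i → node i ≡ nodeOf X → ∃[ j ] node j ≡ nodeOf Y × X at⟨ i ⟩ ⟶* Y at⟨ j ⟩

    infixr 5 _⨾_

    _⨾_ : ∀ {X Y Z} → X ⇝ Y → Y ⇝ Z → X ⇝ Z
    (f ⨾ g) i i≡ = let j , j≡ , ρ = f i i≡ ; k , k≡ , σ = g j j≡ in k , k≡ , ρ ◅◅ σ

    stay : ∀ {X Y} → X ≡ Y → X ⇝ Y
    stay refl i i≡ = i , i≡ , ε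

    node-rule : ∀ {ρ} → ρ ∈ nodeRules → shift ρ ∈ senderRules
    node-rule ρ∈ = there (∈-++⁺ˡ (∈-map⁺ shift ρ∈))

    edge-r : ∀ {n α n′ q u u′ v} → Edge n (r , α) n′ → SenderEffect α u u′ →
      local n q u v ⇝ local n′ q u′ v
    edge-r edge e _ refl = let j , j≡ , ρ∈ = nodeRules-complete edge in
      j , j≡ , senderR (node-rule ρ∈) e ◅ ε

    edge-l : ∀ {n α n′ q u v v′} → Edge n (l , α) n′ → SenderEffect α v v′ →
      local n q u v ⇝ local n′ q u v′
    edge-l edge e _ refl = let j , j≡ , ρ∈ = nodeRules-complete edge in
      j , j≡ , senderL (node-rule ρ∈) e ◅ ε

    relay* : ∀ {p u} a → config p idle (a ∷ u) [ a ] ⟶* config p idle u []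
    relay* a = receiverL (receiverRules-∋ a (here refl)) read
             ◅ receiverR (receiverRules-∋ a (there (here refl))) read ◅ ε

    relay : ∀ {n u} a → local n idle (a ∷ u) [ a ] ⇝ local n idle u []
    relay a i i≡ = i , i≡ , relay* a

    send-all : ∀ {t u} z → local (map send z , t) idle u [] ⇝ local ([] , t) idle (u ++ z) []
    send-all {t} {u} []      = stay (cong (λ w → local ([] , t) idle w []) (sym (++-identityʳ u)))
    send-all {t} {u} (a ∷ z) =
        edge-r act write ⨾ send-all z
      ⨾ stay (cong (λ w → local ([] , t) idle w []) (++-assoc u [ a ] z))

    resting : QConfig → Local
    resting (t , w) = local ([] , t) idle (frames w) []

    -- The right letter is guessed and nothing is lost. The second test comes before the output is
    -- written and therefore sees only the rest of the queue, which must be nonempty for `full` to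
    -- hold.
    simulate : ∀ {X Y} → X ⇉ Y → resting X ⇝ resting Y
    simulate (step {u = []}              _    u≢[]) = ⊥-elim (u≢[] refl)
    simulate (step {s} {x} {u = y ∷ u} refl _)
      rewrite frames-++ (y ∷ u) (proj₁ (δ s x)) =
        edge-r (choose x) ε
      ⨾ edge-l act write ⨾ relay ★ ⨾ edge-r act (test (half-holds x (y ∷ u)))
      ⨾ edge-l act write ⨾ relay (letter x) ⨾ edge-r act (test (full-holds y u))
      ⨾ send-all (frames (proj₁ (δ s x)))

    simulate* : ∀ {X Y} → Star _⇉_ X Y → resting X ⇝ resting Y
    simulate* ε        = stay refl
    simulate* (s ◅ ss) = simulate s ⨾ simulate* ss

    flush-rule : ∀ {i} a → node i ≡ ([] , nothing) → rule i l (msg a) final ∈ nodeRules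
    flush-rule {i} a i≡ = nodeRules-∋ {i} (outgoing-∋ (∈-lookup i) i≡)
      where
      outgoing-∋ : ∀ {n} (n∈ : n ∈ nodes) → n ≡ ([] , nothing) →
        rule i l (msg a) final ∈ outgoing i n n∈
      outgoing-∋ n∈ refl = ∈-map⁺ _ (∈-allFin a)

    -- Every flush rule leads to `final`. Since the content is nonempty, at least one is fired, and
    -- this brings Sender to `final` without any knowledge about the position `i`.
    flush-all : ∀ {i} a u → node i ≡ ([] , nothing) →
      config (at i) idle (a ∷ u) [] ⟶* config (at final) idle [] []
    flush-all a u i≡ = senderL (node-rule (flush-rule a i≡)) write ◅ relay* a ◅◅ rest u
      where
      rest : ∀ u → config (at final) idle u [] ⟶* config (at final) idle [] []
      rest []      = ε
      rest (b ∷ u) = flush-all b u node-final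

    load-all : ∀ {p u} z (z<N : length z < #sender) → (∀ {ρ} → ρ ∈ loadRules z z<N → ρ ∈ senderRules) →
      p ≡ fromℕ< z<N → config p idle u [] ⟶* config zero idle (u ++ z) []
    load-all {u = u} []      z<N sub refl rewrite ++-identityʳ u = ε
    load-all {u = u} (a ∷ z) z<N sub refl rewrite sym (++-assoc u [ a ] z) =
      senderR (sub (here refl)) write ◅ load-all z (<-trans (n<1+n _) z<N) (sub ∘ there) refl

    halts⇒reachable : ∀ {x w} → Star _⇉_ (just start , input) (nothing , x ∷ w) →
      E-E-Reach problem
    halts⇒reachable ρ =
      let j , j≡ , σ = simulate* ρ _ (node-position (resting∈ (just start)))
      in load-all feed ℓ<#sender (there ∘ ∈-++⁺ʳ (map shift nodeRules)) refl
         ◅◅ senderR (here refl) ε ◅ σ ◅◅ flush-all _ _ j≡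

    system-in-class : UCST[ 𝒯 ]₁ʳ system
    system-in-class = All.tabulate (λ ρ∈ → sender-ok (senderRules-sound ρ∈))
                    , All.tabulate (λ ρ∈ → receiver-ok (receiverRules-sound ρ∈))
      where
      receiver-ok : ∀ {q c α q′} → ReceiverRule q c α q′ → ReceiverRuleOK 𝒯 (rule q c α q′)
      receiver-ok (take _)    = tt
      receiver-ok (consume _) = tt

      sender-ok : ∀ {p c α p′} → SenderRule p c α p′ → SenderRuleOK 𝒯 (rule p c α p′)
      sender-ok (enter _)      = tt
      sender-ok (load _ _ _)   = tt
      sender-ok (follow {i} _ e) = edge-ok (All.lookup nodes-ok (∈-lookup i)) e

-- Determinism and passes of queue automata

module QueueProperties {A S : Set} (δ : S → A → List A × Maybe S) where
  open Queue δ

  ⇉⇒⇒ : ∀ {X Y} → X ⇉ Y → X ⇒ Y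
  ⇉⇒⇒ (step eq _) = step eq

  deterministic : ∀ {X Y Z} → X ⇒ Y → X ⇒ Z → Y ≡ Z
  deterministic (step refl) (step refl) = refl

  Trap : S → Set
  Trap s = ∀ {u Z} → (just s , u) ⇒ Z → proj₁ Z ≡ just s

  trapped : ∀ {s} → Trap s → ∀ {u t w} → Star _⇒_ (just s , u) (t , w) → t ≡ just s
  trapped trap ε = refl
  trapped trap (_◅_ {j = _ , _} σ σs) with refl ← trap σ = trapped trap σs

  -- By determinism a halting run retraces the given one. It cannot stop before the trap, since a
  -- halted automaton has no steps, and it never leaves the trap afterwards.
  trap⇒¬halts : ∀ {s} → Trap s → ∀ {X w w′} →
    Star _⇉_ X (just s , w) → ¬ Star _⇒_ X (nothing , w′)
  trap⇒¬halts trap ε        σs       with () ← trapped trap σs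
  trap⇒¬halts trap (ρ ◅ ρs) ε        with () ← ρ
  trap⇒¬halts trap (ρ ◅ ρs) (σ ◅ σs) with refl ← deterministic (⇉⇒⇒ ρ) σ =
    trap⇒¬halts trap ρs σs

  -- The automaton seen as a transducer on a segment of the queue: the output is kept apart from
  -- what follows the segment, so that traces of adjacent segments compose.
  data Trace : S → List A → List A → S → Set where
    []  : ∀ {s} → Trace s [] [] s
    _∷_ : ∀ {s s′ s″ x w xs o} → δ s x ≡ (w , just s′) → Trace s′ xs o s″ →
          Trace s (x ∷ xs) (w ++ o) s″

  trace-cast : ∀ {s xs o o′ s′} → o ≡ o′ → Trace s xs o s′ → Trace s xs o′ s′
  trace-cast refl τ = τ

  infixr 5 _⧺_

  _⧺_ : ∀ {s s′ s″ xs ys o o′} → Trace s xs o s′ → Trace s′ ys o′ s″ →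
    Trace s (xs ++ ys) (o ++ o′) s″
  [] ⧺ τ = τ
  (_∷_ {w = w} {o = o} eq σ) ⧺ τ = trace-cast (sym (++-assoc w o _)) (eq ∷ (σ ⧺ τ))

  trace-map : ∀ {B : Set} {s} {f : B → A} {g : B → List A} →
    (∀ x → δ s (f x) ≡ (g x , just s)) → ∀ xs → Trace s (map f xs) (concatMap g xs) s
  trace-map eq []       = []
  trace-map eq (x ∷ xs) = eq x ∷ trace-map eq xs

  infix 4 _⇉*_

  _⇉*_ : QConfig → QConfig → Set
  _⇉*_ = Star _⇉_

  run-cast : ∀ {t t′ u u′ v v′} → u ≡ u′ → v ≡ v′ → (t , u) ⇉* (t′ , v) → (t , u′) ⇉* (t′ , v′)
  run-cast refl refl ρ = ρ

  ++-≢[] : ∀ {B : Set} (xs : List B) {ys} → ys ≢ [] → xs ++ ys ≢ []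
  ++-≢[] []       ys≢[] = ys≢[]
  ++-≢[] (_ ∷ _)  _     ()

  -- The letter `y` behind the segment keeps the queue nonempty at every step, as `_⇉_` demands.
  run-trace : ∀ {s xs o s′} y ys → Trace s xs o s′ →
    (just s , xs ++ y ∷ ys) ⇉* (just s′ , (y ∷ ys) ++ o)
  run-trace y ys [] = run-cast refl (sym (++-identityʳ (y ∷ ys))) ε
  run-trace {xs = x ∷ xs} y ys (_∷_ {w = w} {o = o} eq τ) =
      step eq (++-≢[] xs (λ ()))
    ◅ run-cast (sym (++-assoc xs (y ∷ ys) w)) (++-assoc (y ∷ ys) w o) (run-trace y (ys ++ w) τ)

  run-pass : ∀ {s xs o s′ y w t} → Trace s xs o s′ → o ≢ [] → δ s′ y ≡ (w , t) →
    (just s , xs ++ [ y ]) ⇉* (t , o ++ w)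
  run-pass {y = y} τ o≢[] eq = run-trace y [] τ ◅◅ step eq o≢[] ◅ ε

-- Templates of codes with holes for numbers found later

data Sign : Set where
  bit  : Bool → Sign
  hole : Sign

lit : List Bool → List Sign
lit = map bit

-- A hole is to be replaced by 2k ones, where k is known only at the end: every
-- pass over the queue writes two ones next to each hole.

grow : Sign → List Sign
grow (bit b) = [ bit b ]
grow hole    = hole ∷ bit true ∷ bit true ∷ []

fill : Sign → List Bool
fill (bit b) = [ b ]
fill hole    = []

ones : ℕ → List Sign
ones k = replicate (k * 2) (bit true)

expand₁ : ℕ → Sign → List Sign
expand₁ k (bit b) = [ bit b ]
expand₁ k hole    = hole ∷ ones k

expand : ℕ → List Sign → List Sign
expand k = concatMap (expand₁ k)

grow-ones : ∀ n → concatMap grow (replicate n (bit true)) ≡ replicate n (bit true)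
grow-ones zero    = refl
grow-ones (suc n) = cong (bit true ∷_) (grow-ones n)

grow-expand : ∀ k xs → concatMap grow (expand k xs) ≡ expand (suc k) xs
grow-expand k []           = refl
grow-expand k (bit b ∷ xs) = cong (bit b ∷_) (grow-expand k xs)
grow-expand k (hole ∷ xs)  = trans (concatMap-++ grow (hole ∷ ones k) (expand k xs))
  (cong₂ (λ y z → hole ∷ bit true ∷ bit true ∷ y ++ z) (grow-ones (k * 2)) (grow-expand k xs))

expand-zero : ∀ xs → expand 0 xs ≡ xs
expand-zero []           = refl
expand-zero (bit b ∷ xs) = cong (bit b ∷_) (expand-zero xs)
expand-zero (hole ∷ xs)  = cong (hole ∷_) (expand-zero xs)

instantiate₁ : ℕ → Sign → List Bool
instantiate₁ k (bit b) = [ b ]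
instantiate₁ k hole    = replicate (k * 2) true

instantiate : ℕ → List Sign → List Bool
instantiate k = concatMap (instantiate₁ k)

fill-ones : ∀ n → concatMap fill (replicate n (bit true)) ≡ replicate n true
fill-ones zero    = refl
fill-ones (suc n) = cong (true ∷_) (fill-ones n)

fill-expand : ∀ k xs → concatMap fill (expand k xs) ≡ instantiate k xs
fill-expand k []           = refl
fill-expand k (bit b ∷ xs) = cong (b ∷_) (fill-expand k xs)
fill-expand k (hole ∷ xs)  = trans (concatMap-++ fill (ones k) (expand k xs))
  (cong₂ _++_ (fill-ones (k * 2)) (fill-expand k xs))

module Blocks {L : Set} (block : L → List Sign) where

  -- A letter is sent as two messages, so 2 · `length ys` messages remain after the frame of `y`;
  -- each hole in its block has received that many ones.
  blocks : List L → List Sign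
  blocks []       = []
  blocks (y ∷ ys) = expand (length ys) (block y) ++ blocks ys

  instantiateBlocks : List L → List Bool
  instantiateBlocks []       = []
  instantiateBlocks (y ∷ ys) = instantiate (length ys) (block y) ++ instantiateBlocks ys

  -- A new last letter adds one to the number of letters behind each earlier one, and `grow` adds
  -- exactly two ones at each hole. So the blocks can be produced with one pass per letter.
  blocks-∷ʳ : ∀ ys z → blocks (ys ++ [ z ]) ≡ concatMap grow (blocks ys) ++ block z
  blocks-∷ʳ []       z = trans (++-identityʳ _) (expand-zero (block z))
  blocks-∷ʳ (y ∷ ys) z = begin
    expand (length (ys ++ [ z ])) (block y) ++ blocks (ys ++ [ z ])
      ≡⟨ cong₂ (λ n w → expand n (block y) ++ w)
           (trans (length-++ ys) (+-comm (length ys) 1)) (blocks-∷ʳ ys z) ⟩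
    expand (suc (length ys)) (block y) ++ concatMap grow (blocks ys) ++ block z
      ≡⟨ cong (_++ concatMap grow (blocks ys) ++ block z) (grow-expand (length ys) (block y)) ⟨
    concatMap grow (expand (length ys) (block y)) ++ concatMap grow (blocks ys) ++ block z
      ≡⟨ ++-assoc (concatMap grow (expand (length ys) (block y))) _ _ ⟨
    (concatMap grow (expand (length ys) (block y)) ++ concatMap grow (blocks ys)) ++ block z
      ≡⟨ cong (_++ block z) (concatMap-++ grow (expand (length ys) (block y)) (blocks ys)) ⟨
    concatMap grow (blocks (y ∷ ys)) ++ block z ∎
    where open ≡-Reasoning

  fill-blocks : ∀ ys → concatMap fill (blocks ys) ≡ instantiateBlocks ys
  fill-blocks []       = refl
  fill-blocks (y ∷ ys) = trans (concatMap-++ fill (expand (length ys) (block y)) (blocks ys))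
    (cong₂ _++_ (fill-expand (length ys) (block y)) (fill-blocks ys))

-- The queue automaton that writes its own instance's code and runs the Turing machine on it

module Machine (T : TM) where
  open TM T
  open Computation T

  Sym : Set
  Sym = Symbol #work

  data Letter : Set where
    raw cooked : Sign → Letter
    cell        : Sym → Letter
    hd       : Fin #states → Sym → Letter
    end        : Letter

  -- `carry y` remembers the sign whose block is due at the end of the pass, and `enter q` puts the
  -- head on the next letter. `dead` serves both for acceptance and for ill-formed queues.
  data State : Set where
    search   : State
    carry    : Sign → State
    finalize : State
    scan     : Maybe Sym → State
    enter    : Fin #states → State
    copy     : State
    dead     : State

  private
    signs : List Sign
    signs = hole ∷ bit true ∷ bit false ∷ []

    sign∈ : ∀ x → x ∈ signs
    sign∈ hole        = here refl
    sign∈ (bit true)  = there (here refl)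
    sign∈ (bit false) = there (there (here refl))

    syms : List Sym
    syms = blank ∷ input true ∷ input false ∷ map work (allFin #work)

    sym∈ : ∀ x → x ∈ syms
    sym∈ blank         = here refl
    sym∈ (input true)  = there (here refl)
    sym∈ (input false) = there (there (here refl))
    sym∈ (work i)      = there (there (there (∈-map⁺ work (∈-allFin i))))

    symLetters headLetters : List Letter
    symLetters  = map cell syms
    headLetters = cartesianProductWith hd (allFin #states) syms

  finiteLetter : Finite Letter
  finiteLetter = record
    { elements = end ∷ map raw signs ++ map cooked signs ++ symLetters ++ headLetters
    ; complete = λ where
        end        → here refl
        (raw x)    → there (∈-++⁺ˡ (∈-map⁺ raw (sign∈ x)))
        (cooked x) → there (∈-++⁺ʳ (map raw signs) (∈-++⁺ˡ (∈-map⁺ cooked (sign∈ x))))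
        (cell x)    → there (∈-++⁺ʳ (map raw signs) (∈-++⁺ʳ (map cooked signs)
                       (∈-++⁺ˡ (∈-map⁺ cell (sym∈ x)))))
        (hd q x) → there (∈-++⁺ʳ (map raw signs) (∈-++⁺ʳ (map cooked signs)
                       (∈-++⁺ʳ symLetters (∈-cartesianProductWith⁺ hd (∈-allFin q) (sym∈ x)))))
    }

  private
    scans : List (Maybe Sym)
    scans = nothing ∷ map just syms

  finiteState : Finite State
  finiteState = record
    { elements = search ∷ finalize ∷ copy ∷ dead ∷
                 map carry signs ++ map scan scans ++ map enter (allFin #states)
    ; complete = λ where
        search          → here refl
        finalize        → there (here refl)
        copy            → there (there (here refl))
        dead            → there (there (there (here refl)))
        (carry x)       → skip (∈-++⁺ˡ (∈-map⁺ carry (sign∈ x)))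
        (scan nothing)  → skip (∈-++⁺ʳ (map carry signs) (here refl))
        (scan (just x)) → skip (∈-++⁺ʳ (map carry signs) (∈-++⁺ˡ (∈-map⁺ scan (there (∈-map⁺ just (sym∈ x))))))
        (enter q)       → skip (∈-++⁺ʳ (map carry signs) (∈-++⁺ʳ (map scan scans)
                            (∈-map⁺ enter (∈-allFin q))))
    }
    where
    skip : ∀ {A : Set} {a b c d x : A} {xs} → x ∈ xs → x ∈ a ∷ b ∷ c ∷ d ∷ xs
    skip = there ∘ there ∘ there ∘ there

  open Framing finiteLetter
  open Receiver finiteLetter

  counter : ℕ → List Sign
  counter j = replicate j (bit true) ++ hole ∷ bit false ∷ []

  -- The list item that encodes a rule writing a, for the target state 2k + j
  -- when the hole stands for 2k ones.

  writeTemplate : ℕ → Fin #msgs → List Sign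
  writeTemplate j a =
    bit true ∷ counter (suc j) ++ lit (false ∷ false ∷ true ∷ encodeFin a) ++ counter j

  -- With 2k messages left after the frame, the chain passes through the states 2k + 2, 2k + 1 and
  -- 2k; hence the offsets 1 and 0 of the two targets.
  block : Letter → List Sign
  block y = writeTemplate 1 ★ ++ writeTemplate 0 (letter y)

  -- The first `false` closes the list of Sender rules, whose last items are the blocks.
  tailCode : List Bool
  tailCode = false ∷ encodeList encodeRule receiverRules

  inputs : List Bool → List Letter
  inputs = map (cell ∘ input)

  emit : Maybe Sym → List Letter
  emit nothing  = []
  emit (just x) = [ cell x ]

  -- The diagonal twist is made here: acceptance leads to the trap, rejection to halting.
  move : Maybe Sym → Control #states × Sym × Move → List Letter × Maybe State
  move c (run q , x , left)  = hd q (fromMaybe blank c) ∷ cell x ∷ [] , just copy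
  move c (run q , x , right) = emit c ++ [ cell x ] , just (enter q)
  move c (accept , _)        = [] , just dead
  move c (reject , _)        = [] , nothing

  -- The ones beside a raw hole are cooked from the beginning: they are no letters of the initial
  -- queue, so no block must be made for them.
  regrow : Sign → List Letter
  regrow (bit b) = [ raw (bit b) ]
  regrow hole    = raw hole ∷ cooked (bit true) ∷ cooked (bit true) ∷ []

  -- A pass in search or carry turns the first raw sign into a cooked one and
  -- appends its block, so that cooked signs are already copied. In scan the cells
  -- are delayed by one, which provides the cell to the left of the head.

  next : State → Letter → List Letter × Maybe State
  next dead      _          = [] , just dead
  next search    (raw x)    = map cooked (grow x) , just (carry x)
  next search    (cooked x) = map cooked (grow x) , just search
  next search    end        = map cooked (block end) ++ [ end ] , just finalize
  next (carry y) (raw x)    = regrow x , just (carry y)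
  next (carry y) (cooked x) = map cooked (grow x) , just (carry y)
  next (carry y) end        = map cooked (block (raw y)) ++ [ end ] , just search
  next finalize  (cooked x) = inputs (fill x) , just finalize
  next finalize  end        = inputs tailCode ++ [ end ] , just (enter start)
  next (enter q) (cell x)    = [ hd q x ] , just copy
  next (enter q) end        = hd q blank ∷ end ∷ [] , just (scan nothing)
  next (scan c)  (cell x)    = emit c , just (scan (just x))
  next (scan c)  (hd q x) = move c (δ q x)
  next copy      (cell x)    = [ cell x ] , just copy
  next copy      end        = [ end ] , just (scan nothing)
  next _         _          = [] , just dead

  open Queue next
  open QueueProperties next
  open Blocks block

  -- Self-reproduction

  trace-cooked : ∀ {s} → (∀ x → next s (cooked x) ≡ (map cooked (grow x) , just s)) →
    ∀ xs → Trace s (map cooked xs) (map cooked (concatMap grow xs)) s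
  trace-cooked eq xs = trace-cast (sym (map-concatMap cooked grow xs)) (trace-map eq xs)

  cookedOnes : ℕ → List Letter
  cookedOnes k = map cooked (ones k)

  mixed₁ : ℕ → Sign → List Letter
  mixed₁ k (bit b) = [ raw (bit b) ]
  mixed₁ k hole    = raw hole ∷ cookedOnes k

  mixed : ℕ → List Sign → List Letter
  mixed k = concatMap (mixed₁ k)

  mixed-zero : ∀ xs → mixed 0 xs ≡ map raw xs
  mixed-zero []           = refl
  mixed-zero (bit b ∷ xs) = cong (raw (bit b) ∷_) (mixed-zero xs)
  mixed-zero (hole ∷ xs)  = cong (raw hole ∷_) (mixed-zero xs)

  trace-ones : ∀ y k → Trace (carry y) (cookedOnes k) (cookedOnes k) (carry y)
  trace-ones y k = trace-cast (cong (map cooked) (grow-ones (k * 2)))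
    (trace-cooked (λ _ → refl) (ones k))

  trace-found : ∀ k x → Trace search (mixed₁ k x) (map cooked (expand₁ (suc k) x)) (carry x)
  trace-found k (bit b) = refl ∷ []
  trace-found k hole    = refl ∷ trace-ones hole k

  trace-mixed : ∀ y k xs → Trace (carry y) (mixed k xs) (mixed (suc k) xs) (carry y)
  trace-mixed y k []           = []
  trace-mixed y k (bit b ∷ xs) = refl ∷ trace-mixed y k xs
  trace-mixed y k (hole ∷ xs)  = (refl ∷ trace-ones y k) ⧺ trace-mixed y k xs

  trace-expanded : ∀ k xs →
    Trace search (map cooked (expand k xs)) (map cooked (expand (suc k) xs)) search
  trace-expanded k xs = trace-cast (cong (map cooked) (grow-expand k xs))
    (trace-cooked (λ _ → refl) (expand k xs))

  -- The queue after `k` passes, with `xs` copied and `ys` not. Holes of the program have grown in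
  -- all `k` passes, those of a block only in the passes since it was appended.
  stage : ℕ → List Sign → List Sign → List Letter
  stage k xs ys = (map cooked (expand k xs) ++ mixed k ys ++ map cooked (blocks (map raw xs))) ++ [ end ]

  expand₁≢[] : ∀ k x {zs ws : List Letter} → (map cooked (expand₁ k x) ++ zs) ++ ws ≢ []
  expand₁≢[] k (bit _) ()
  expand₁≢[] k hole    ()

  -- One pass, composed of the traces of four zones: copied signs, the sign `x` with its ones, raw
  -- signs, and older blocks. The block of `x` is then written at the end marker.
  copy-sign : ∀ k xs x ys →
    (just search , stage k xs (x ∷ ys)) ⇉* (just search , stage (suc k) (xs ++ [ x ]) ys)
  copy-sign k xs x ys = run-cast refl shape
    (run-pass
      (trace-expanded k xs ⧺ (trace-found k x ⧺ trace-mixed x k ys) ⧺ trace-cooked (λ _ → refl) old)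
      (++-≢[] (map cooked (expand (suc k) xs)) (expand₁≢[] (suc k) x)) refl)
    where
    old = blocks (map raw xs)

    expanded : map cooked (expand (suc k) (xs ++ [ x ])) ≡
               map cooked (expand (suc k) xs) ++ map cooked (expand₁ (suc k) x)
    expanded = trans (cong (map cooked) (trans (concatMap-++ (expand₁ (suc k)) xs [ x ])
        (cong (expand (suc k) xs ++_) (++-identityʳ (expand₁ (suc k) x)))))
      (map-++ cooked (expand (suc k) xs) _)

    appended : map cooked (blocks (map raw (xs ++ [ x ]))) ≡
               map cooked (concatMap grow old) ++ map cooked (block (raw x))
    appended = trans (cong (map cooked)
        (trans (cong blocks (map-++ raw xs [ x ])) (blocks-∷ʳ (map raw xs) (raw x))))
      (map-++ cooked (concatMap grow old) _)

    reassociate : ∀ (a b c d e f : List Letter) →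
      (a ++ (b ++ c) ++ d) ++ e ++ f ≡ ((a ++ b) ++ c ++ d ++ e) ++ f
    reassociate a b c d e f = solve (++-monoid Letter)

    shape : (map cooked (expand (suc k) xs) ++
             (map cooked (expand₁ (suc k) x) ++ mixed (suc k) ys) ++
             map cooked (concatMap grow old)) ++ map cooked (block (raw x)) ++ [ end ]
          ≡ stage (suc k) (xs ++ [ x ]) ys
    shape = trans
      (reassociate (map cooked (expand (suc k) xs)) (map cooked (expand₁ (suc k) x))
        (mixed (suc k) ys) (map cooked (concatMap grow old)) (map cooked (block (raw x))) [ end ])
      (cong₂ (λ u v → (u ++ mixed (suc k) ys ++ v) ++ [ end ])
        (sym expanded) (sym appended))

  copy-signs : ∀ k xs ys → k ≡ length xs →
    (just search , stage k xs ys) ⇉* (just search , stage (length (xs ++ ys)) (xs ++ ys) [])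
  copy-signs k xs [] refl = run-cast refl
    (cong (λ zs → stage (length zs) zs []) (sym (++-identityʳ xs))) ε
  copy-signs k xs (y ∷ ys) refl = copy-sign k xs y ys ◅◅
    run-cast refl (cong (λ zs → stage (length zs) zs []) (++-assoc xs [ y ] ys))
      (copy-signs (suc k) (xs ++ [ y ]) ys (sym (trans (length-++ xs) (+-comm (length xs) 1))))

  module Bootstrap (b : Bool) (rest : List Sign) where

    -- The first sign is a bit, so the outputs of the last two passes are visibly nonempty.
    program : List Sign
    program = bit b ∷ rest

    queue : List Letter
    queue = map raw program ++ [ end ]

    n : ℕ
    n = length queue

    selfCode : List Bool
    selfCode = instantiate n program ++ instantiateBlocks queue ++ tailCode

    private
      k : ℕ
      k = length program

      n≡ : n ≡ suc k
      n≡ = trans (length-++ (map raw program))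
        (trans (cong (_+ 1) (length-map raw program)) (+-comm k 1))

      old template : List Sign
      old      = blocks (map raw program)
      template = expand (suc k) program ++ blocks queue

    begin-stage : (just search , queue) ⇉* (just search , stage 0 [] program)
    begin-stage = run-cast refl (cong (_++ [ end ])
      (trans (sym (mixed-zero program)) (sym (++-identityʳ (mixed 0 program))))) ε

    -- The pass that finds no raw sign accounts for `end`, which is also a letter of the initial
    -- queue. It lets the holes of the program grow `n` times in all, one more than the program has
    -- signs.
    last-block : (just search , stage k program []) ⇉* (just finalize , map cooked template ++ [ end ])
    last-block = run-cast refl shape
      (run-pass (trace-expanded k program ⧺ trace-cooked (λ _ → refl) old) (λ ()) refl)
      where
      shape : (map cooked (expand (suc k) program) ++ map cooked (concatMap grow old)) ++
                map cooked (block end) ++ [ end ]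
            ≡ map cooked template ++ [ end ]
      shape = begin
        (map cooked (expand (suc k) program) ++ map cooked (concatMap grow old)) ++ map cooked (block end) ++ [ end ]
          ≡⟨ reassociate (map cooked (expand (suc k) program)) (map cooked (concatMap grow old)) (map cooked (block end)) [ end ] ⟩
        (map cooked (expand (suc k) program) ++ map cooked (concatMap grow old) ++ map cooked (block end)) ++ [ end ]
          ≡⟨ cong (λ u → (map cooked (expand (suc k) program) ++ u) ++ [ end ]) (map-++ cooked (concatMap grow old) (block end)) ⟨
        (map cooked (expand (suc k) program) ++ map cooked (concatMap grow old ++ block end)) ++ [ end ]
          ≡⟨ cong (λ u → (map cooked (expand (suc k) program) ++ map cooked u) ++ [ end ]) (blocks-∷ʳ (map raw program) end) ⟨
        (map cooked (expand (suc k) program) ++ map cooked (blocks queue)) ++ [ end ]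
          ≡⟨ cong (_++ [ end ]) (map-++ cooked (expand (suc k) program) (blocks queue)) ⟨
        map cooked template ++ [ end ] ∎
        where
        open ≡-Reasoning
        reassociate : ∀ (a b c d : List Letter) → (a ++ b) ++ c ++ d ≡ (a ++ b ++ c) ++ d
        reassociate a b c d = solve (++-monoid Letter)

    fill-template : concatMap fill template ≡ instantiate n program ++ instantiateBlocks queue
    fill-template = trans (concatMap-++ fill (expand (suc k) program) (blocks queue))
      (cong₂ _++_ (trans (fill-expand (suc k) program) (cong (λ m → instantiate m program) (sym n≡)))
                  (fill-blocks queue))

    erase-holes : (just finalize , map cooked template ++ [ end ]) ⇉*
                  (just (enter start) , inputs selfCode ++ [ end ])
    erase-holes = run-cast refl shape (run-pass (trace-map (λ _ → refl) template) (λ ()) refl)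
      where
      shape : concatMap (inputs ∘ fill) template ++ inputs tailCode ++ [ end ] ≡ inputs selfCode ++ [ end ]
      shape = begin
        concatMap (inputs ∘ fill) template ++ inputs tailCode ++ [ end ]
          ≡⟨ cong (_++ inputs tailCode ++ [ end ]) (map-concatMap (cell ∘ input) fill template) ⟨
        inputs (concatMap fill template) ++ inputs tailCode ++ [ end ]
          ≡⟨ ++-assoc (inputs (concatMap fill template)) _ _ ⟨
        (inputs (concatMap fill template) ++ inputs tailCode) ++ [ end ]
          ≡⟨ cong (_++ [ end ]) (map-++ (cell ∘ input) (concatMap fill template) tailCode) ⟨
        inputs (concatMap fill template ++ tailCode) ++ [ end ]
          ≡⟨ cong (λ w → inputs (w ++ tailCode) ++ [ end ]) fill-template ⟩
        inputs ((instantiate n program ++ instantiateBlocks queue) ++ tailCode) ++ [ end ]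
          ≡⟨ cong (λ w → inputs w ++ [ end ]) (++-assoc (instantiate n program) _ _) ⟩
        inputs selfCode ++ [ end ] ∎
        where open ≡-Reasoning

    bootstrap : (just search , queue) ⇉* (just (enter start) , inputs selfCode ++ [ end ])
    bootstrap = begin-stage ◅◅ copy-signs 0 [] program refl ◅◅ last-block ◅◅ erase-holes

  -- Simulation of the Turing machine

  cells : List Sym → List Letter
  cells = map cell

  content : Fin #states → Tape #work → List Letter
  content q (tape ls s rs) = cells (reverse ls) ++ hd q s ∷ cells rs ++ [ end ]

  trace-copy : ∀ xs → Trace copy (cells xs) (cells xs) copy
  trace-copy []       = []
  trace-copy (x ∷ xs) = refl ∷ trace-copy xs

  trace-scan : ∀ c xs x → Trace (scan c) (cells (xs ++ [ x ])) (emit c ++ cells xs) (scan (just x))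
  trace-scan c []       x = refl ∷ []
  trace-scan c (y ∷ xs) x = refl ∷ trace-scan (just y) xs x

  -- The cell withheld on arrival at the head is its left neighbour, which is the first of `ls`
  -- because `ls` is listed from the head outwards.
  trace-left : ∀ ls →
    Trace (scan nothing) (cells (reverse ls)) (cells (reverse (drop 1 ls))) (scan (List.head ls))
  trace-left []       = []
  trace-left (t ∷ ls) rewrite unfold-reverse t ls = trace-scan nothing (reverse ls) t

  emit-left : ∀ ls → cells (reverse (drop 1 ls)) ++ emit (List.head ls) ≡ cells (reverse ls)
  emit-left []       = refl
  emit-left (t ∷ ls) rewrite unfold-reverse t ls = sym (map-++ cell (reverse ls) [ t ])

  cells-∷ : ∀ ls s → cells (reverse ls) ++ [ cell s ] ≡ cells (reverse (s ∷ ls))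
  cells-∷ ls s = trans (sym (map-++ cell (reverse ls) [ s ])) (cong cells (sym (unfold-reverse s ls)))

  reassoc : ∀ (xs : List Letter) {y} ys → (xs ++ y ∷ ys) ++ [ end ] ≡ xs ++ y ∷ ys ++ [ end ]
  reassoc xs ys = ++-assoc xs _ [ end ]

  -- Common to the start of the Turing machine and to its moves to the right: the head is put on the
  -- first cell of `rs`, or on a new blank before `end`.
  content-right : ∀ {s u o} q ls rs → Trace s u o (enter q) → o ≡ cells (reverse ls) →
    cells (reverse ls) ++ cells rs ≢ [] →
    (just s , u ++ cells rs ++ [ end ]) ⇉* (just (scan nothing) , content q (fromRight ls rs))
  content-right q ls [] τ refl o≢[] =
    run-pass τ (λ o≡[] → o≢[] (trans (++-identityʳ _) o≡[])) refl
  content-right {u = u} q ls (x ∷ rs) τ refl _ =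
    run-cast (++-assoc u _ [ end ]) (reassoc (cells (reverse ls)) (cells rs))
      (run-pass (τ ⧺ refl ∷ trace-copy rs) (++-≢[] (cells (reverse ls)) λ ()) refl)

  start-run : ∀ b w →
    (just (enter start) , inputs (b ∷ w) ++ [ end ]) ⇉*
    (just (scan nothing) , uncurry (λ _ → content start) (initial (b ∷ w)))
  start-run b w = run-cast (cong (λ z → cell (input b) ∷ z ++ [ end ]) (sym (map-∘ w))) refl
    (content-right start [] (map input (b ∷ w)) [] refl (λ ()))

  simulate-step : ∀ {q t q′ t′} → (run q , t) ⊢ (run q′ , t′) →
    (just (scan nothing) , content q t) ⇉* (just (scan nothing) , content q′ t′)
  simulate-step {q} {tape ls s rs} {q′} (step {s = s′} {right} eq) =
    run-cast (++-assoc (cells (reverse ls)) [ hd q s ] _) refl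
      (content-right q′ (s′ ∷ ls) rs (trace-left ls ⧺ cong (move (List.head ls)) eq ∷ [])
        written nonempty)
    where
    written : cells (reverse (drop 1 ls)) ++ (emit (List.head ls) ++ [ cell s′ ]) ++ [] ≡
              cells (reverse (s′ ∷ ls))
    written = begin
      cells (reverse (drop 1 ls)) ++ (emit (List.head ls) ++ [ cell s′ ]) ++ []
        ≡⟨ cong (cells (reverse (drop 1 ls)) ++_) (++-identityʳ _) ⟩
      cells (reverse (drop 1 ls)) ++ emit (List.head ls) ++ [ cell s′ ]
        ≡⟨ ++-assoc (cells (reverse (drop 1 ls))) _ _ ⟨
      (cells (reverse (drop 1 ls)) ++ emit (List.head ls)) ++ [ cell s′ ]
        ≡⟨ cong (_++ [ cell s′ ]) (emit-left ls) ⟩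
      cells (reverse ls) ++ [ cell s′ ]
        ≡⟨ cells-∷ ls s′ ⟩
      cells (reverse (s′ ∷ ls)) ∎
      where open ≡-Reasoning
    nonempty : cells (reverse (s′ ∷ ls)) ++ cells rs ≢ []
    nonempty eq = ++-≢[] (cells (reverse ls)) {cell s′ ∷ cells rs} (λ ())
      (trans (sym (++-assoc (cells (reverse ls)) _ _)) (trans (cong (_++ cells rs) (cells-∷ ls s′)) eq))
  simulate-step {q} {tape ls s rs} {q′} (step {s = s′} {left} eq) =
    run-cast (reassoc (cells (reverse ls)) (cells rs)) (shape ls)
      (run-pass (trace-left ls ⧺ cong (move (List.head ls)) eq ∷ trace-copy rs)
        (++-≢[] (cells (reverse (drop 1 ls))) λ ()) refl)
    where
    shape : ∀ ls → (cells (reverse (drop 1 ls)) ++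
                    hd q′ (fromMaybe blank (List.head ls)) ∷ cell s′ ∷ cells rs) ++ [ end ]
                 ≡ content q′ (writeMove s′ left (tape ls s rs))
    -- At the left end no cell was withheld, and the blank put under the head is the one that
    -- `writeMove` supplies.
    shape []       = refl
    shape (t ∷ ls) = reassoc (cells (reverse ls)) (cell s′ ∷ cells rs)

  -- At least `end` stands behind the head, so the queue is nonempty on halting, as
  -- `halts⇒reachable` asks.
  halting-step : ∀ {q c s d t} (tp : Tape #work) → δ q (Tape.scanned tp) ≡ (c , s , d) →
    (∀ m → move m (c , s , d) ≡ ([] , t)) →
    ∃₂ λ y w → (just (scan nothing) , content q tp) ⇉* (t , y ∷ w)
  halting-step (tape ls s rs) eq halt = nonempty (cells rs)
    where
    step′ = trans (cong (move (List.head ls)) eq) (halt (List.head ls))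
    nonempty : ∀ u → ∃₂ λ y w → (just (scan nothing) , cells (reverse ls) ++ hd _ s ∷ u ++ [ end ]) ⇉* (_ , y ∷ w)
    nonempty []      = end , _ , (run-trace _ _ (trace-left ls) ◅◅ step step′ (λ ()) ◅ ε)
    nonempty (y ∷ u) = y , _ , (run-trace _ _ (trace-left ls) ◅◅ step step′ (λ ()) ◅ ε)

  data Halting : Control #states → Maybe State → Set where
    accepting : Halting accept (just dead)
    rejecting : Halting reject nothing

  halting-move : ∀ {c t} → Halting c t → ∀ m {s d} → move m (c , s , d) ≡ ([] , t)
  halting-move accepting m = refl
  halting-move rejecting m = refl

  simulate-run : ∀ {q tp c tp′ t} → Halting c t → Star _⊢_ (run q , tp) (c , tp′) →
    ∃₂ λ y w → (just (scan nothing) , content q tp) ⇉* (t , y ∷ w)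
  simulate-run h (σ@(step {c = run q′} _) ◅ σs) =
    let y , w , ρ = simulate-run h σs in y , w , simulate-step σ ◅◅ ρ
  simulate-run {tp = tp} h (step {c = accept} {s} {d} eq ◅ ε) =
    halting-step tp eq (λ m → halting-move h m {s} {d})
  simulate-run {tp = tp} h (step {c = reject} {s} {d} eq ◅ ε) =
    halting-step tp eq (λ m → halting-move h m {s} {d})

  module SelfReference (b : Bool) (rest : List Sign) where
    open Bootstrap b rest

    simulate-T : ∀ {b′ w c tp t} → selfCode ≡ b′ ∷ w → Halting c t →
      Star _⊢_ (initial (b′ ∷ w)) (c , tp) → ∃₂ λ y w → (just search , queue) ⇉* (t , y ∷ w)
    simulate-T {b′} {w} eq h σ = let y , v , ρ = simulate-run h σ in
      y , v , bootstrap ◅◅ run-cast (cong (λ z → inputs z ++ [ end ]) (sym eq)) refl (start-run b′ w) ◅◅ ρ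

-- Unary numbers and lists in templates

encodeℕ-replicate : ∀ a b → encodeℕ (a + b) ≡ replicate a true ++ encodeℕ b
encodeℕ-replicate zero    b = refl
encodeℕ-replicate (suc a) b = cong (true ∷_) (encodeℕ-replicate a b)

instantiate-++ : ∀ n xs ys → instantiate n (xs ++ ys) ≡ instantiate n xs ++ instantiate n ys
instantiate-++ n = concatMap-++ (instantiate₁ n)

instantiate-lit : ∀ n w → instantiate n (lit w) ≡ w
instantiate-lit n []      = refl
instantiate-lit n (b ∷ w) = cong (b ∷_) (instantiate-lit n w)

encodeItems : {B : Set} → (B → List Bool) → List B → List Bool
encodeItems enc = concatMap (λ x → true ∷ enc x)

encodeList-++ : ∀ {B : Set} (enc : B → List Bool) xs ys →
  encodeList enc (xs ++ ys) ≡ encodeItems enc xs ++ encodeList enc ys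
encodeList-++ enc []       ys = refl
encodeList-++ enc (x ∷ xs) ys = cong (true ∷_)
  (trans (cong (enc x ++_) (encodeList-++ enc xs ys)) (sym (++-assoc (enc x) _ _)))

encodeList-items : ∀ {B : Set} (enc : B → List Bool) xs →
  encodeList enc xs ≡ encodeItems enc xs ++ [ false ]
encodeList-items enc xs = trans (cong (encodeList enc) (sym (++-identityʳ xs))) (encodeList-++ enc xs [])

-- The self-referential instance and the contradiction

module Diagonal (𝒯 : {m : ℕ} → Reg m → Set)
  (tests : ∀ {A : Set} (finiteA : Finite A) → Tests 𝒯 finiteA) (T : TM) where

  open Machine T
  open Framing finiteLetter
  open Receiver finiteLetter
  open Relay 𝒯 finiteLetter (tests finiteLetter) finiteState next
  open Blocks block

  -- The number of `at i` is `suc ℓ + toℕ i`: the first bit is the successor, the hole stands for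
  -- the `ℓ` ones.
  stateTemplate : Fin #nodes → List Sign
  stateTemplate i = bit true ∷ hole ∷ lit (encodeFin i)

  actionCode : Channel → Act #msgs → List Bool
  actionCode c α = encodeChannel c ++ encodeAct α

  ruleTemplate : Rule #msgs #nodes → List Sign
  ruleTemplate (rule i c α j) = stateTemplate i ++ lit (actionCode c α) ++ stateTemplate j

  rulesTemplate : List (Rule #msgs #nodes) → List Sign
  rulesTemplate = concatMap (λ ρ → bit true ∷ ruleTemplate ρ)

  entryTemplate : List Sign
  entryTemplate = bit false ∷ lit (actionCode r ε) ++ stateTemplate (position (resting∈ (just search)))

  -- The code of `#msgs`, a successor, begins with the `true` passed to `Bootstrap`; the rest of it
  -- stands first here. There is no circularity: nodes and their rules are fixed before the queue
  -- is, and only the holes depend on its length.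
  preamble : List Sign
  preamble =
    lit (encodeℕ size) ++ (bit true ∷ hole ∷ lit (encodeℕ #nodes)) ++ lit (encodeℕ #receiver) ++
    (hole ∷ bit false ∷ []) ++ stateTemplate final ++ lit (encodeFin idle ++ encodeFin idle) ++
    (bit true ∷ entryTemplate) ++ rulesTemplate nodeRules
    where open Finite finiteLetter

  open Bootstrap true preamble
  open SelfReference true preamble
  open System search queue

  ℓ≡ : ℓ ≡ n * 2
  ℓ≡ = length-frames queue

  ones-ℓ : replicate (n * 2) true ≡ replicate ℓ true
  ones-ℓ = cong (λ k → replicate k true) (sym ℓ≡)

  instantiate-offset : ∀ w → instantiate n (bit true ∷ hole ∷ lit w) ≡ true ∷ replicate ℓ true ++ w
  instantiate-offset w = cong (true ∷_) (cong₂ _++_ ones-ℓ (instantiate-lit n w))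

  instantiate-state : ∀ i → instantiate n (stateTemplate i) ≡ encodeFin (at i)
  instantiate-state i = trans (instantiate-offset (encodeFin i))
    (trans (sym (encodeℕ-replicate (suc ℓ) (toℕ i))) (cong encodeℕ (sym (toℕ-↑ʳ (suc ℓ) i))))

  instantiate-#sender : instantiate n (bit true ∷ hole ∷ lit (encodeℕ #nodes)) ≡ encodeℕ #sender
  instantiate-#sender = trans (instantiate-offset (encodeℕ #nodes))
    (sym (encodeℕ-replicate (suc ℓ) #nodes))

  instantiate-p-in : instantiate n (hole ∷ bit false ∷ []) ≡ encodeFin (fromℕ< ℓ<#sender)
  instantiate-p-in = trans (cong (_++ [ false ]) ones-ℓ)
    (trans (sym (encodeℕ-replicate ℓ 0))
      (cong encodeℕ (trans (+-identityʳ ℓ) (sym (toℕ-fromℕ< ℓ<#sender)))))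

  instantiate-rule : ∀ ρ → instantiate n (ruleTemplate ρ) ≡ encodeRule (shift ρ)
  instantiate-rule (rule i c α j) = begin
    instantiate n (stateTemplate i ++ lit (actionCode c α) ++ stateTemplate j)
      ≡⟨ instantiate-++ n (stateTemplate i) _ ⟩
    instantiate n (stateTemplate i) ++ instantiate n (lit (actionCode c α) ++ stateTemplate j)
      ≡⟨ cong₂ _++_ (instantiate-state i) (instantiate-++ n (lit (actionCode c α)) _) ⟩
    encodeFin (at i) ++ instantiate n (lit (actionCode c α)) ++ instantiate n (stateTemplate j)
      ≡⟨ cong₂ (λ u v → encodeFin (at i) ++ u ++ v) (instantiate-lit n (actionCode c α)) (instantiate-state j) ⟩
    encodeFin (at i) ++ (encodeChannel c ++ encodeAct α) ++ encodeFin (at j)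
      ≡⟨ cong (encodeFin (at i) ++_) (++-assoc (encodeChannel c) (encodeAct α) _) ⟩
    encodeRule (shift (rule i c α j)) ∎
    where open ≡-Reasoning

  instantiate-rules : ∀ ρs → instantiate n (rulesTemplate ρs) ≡
    encodeItems encodeRule (map shift ρs)
  instantiate-rules []       = refl
  instantiate-rules (ρ ∷ ρs) = cong (true ∷_) (trans (instantiate-++ n (ruleTemplate ρ) _)
    (cong₂ _++_ (instantiate-rule ρ) (instantiate-rules ρs)))

  instantiate-entry : instantiate n entryTemplate ≡ encodeRule entry
  instantiate-entry = cong (λ w → false ∷ false ∷ true ∷ false ∷ w) (instantiate-state entryPoint)

  instantiate-counter : ∀ j k → instantiate k (counter j) ≡ encodeℕ (j + k * 2)
  instantiate-counter zero    k = trans (sym (encodeℕ-replicate (k * 2) 0)) (cong encodeℕ (+-identityʳ (k * 2)))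
  instantiate-counter (suc j) k = cong (true ∷_) (instantiate-counter j k)

  instantiate-write : ∀ j k a {m} {p p′ : Fin m} → toℕ p ≡ suc j + k * 2 → toℕ p′ ≡ j + k * 2 →
    instantiate k (writeTemplate j a) ≡ true ∷ encodeRule (rule p r (msg a) p′)
  instantiate-write j k a {p = p} {p′} p≡ p′≡ = cong (true ∷_) (begin
    instantiate k (counter (suc j) ++ lit mid ++ counter j)
      ≡⟨ instantiate-++ k (counter (suc j)) _ ⟩
    instantiate k (counter (suc j)) ++ instantiate k (lit mid ++ counter j)
      ≡⟨ cong₂ _++_ (instantiate-counter (suc j) k) (instantiate-++ k (lit mid) (counter j)) ⟩
    encodeℕ (suc j + k * 2) ++ instantiate k (lit mid) ++ instantiate k (counter j)
      ≡⟨ cong₂ (λ u v → encodeℕ (suc j + k * 2) ++ u ++ v) (instantiate-lit k mid) (instantiate-counter j k) ⟩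
    encodeℕ (suc j + k * 2) ++ mid ++ encodeℕ (j + k * 2)
      ≡⟨ cong₂ (λ x y → encodeℕ x ++ mid ++ encodeℕ y) p≡ p′≡ ⟨
    encodeRule (rule p r (msg a) p′) ∎)
    where
    open ≡-Reasoning
    mid = false ∷ false ∷ true ∷ encodeFin a

  instantiate-blocks : ∀ ys (lt : length (frames ys) < #sender) →
    instantiateBlocks ys ≡ encodeItems encodeRule (loadRules (frames ys) lt)
  instantiate-blocks []       lt = refl
  instantiate-blocks (y ∷ ys) lt = begin
    instantiate k (block y) ++ instantiateBlocks ys
      ≡⟨ cong₂ _++_ (instantiate-++ k (writeTemplate 1 ★) (writeTemplate 0 (letter y))) (instantiate-blocks ys lt₂) ⟩
    (instantiate k (writeTemplate 1 ★) ++ instantiate k (writeTemplate 0 (letter y))) ++ rest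
      ≡⟨ cong₂ (λ u v → (u ++ v) ++ rest)
           (instantiate-write 1 k ★ (state≡ 2 lt) (state≡ 1 lt₁))
           (instantiate-write 0 k (letter y) (state≡ 1 lt₁) (state≡ 0 lt₂)) ⟩
    (item₁ ++ item₂) ++ rest
      ≡⟨ ++-assoc item₁ item₂ rest ⟩
    encodeItems encodeRule (loadRules (frames (y ∷ ys)) lt) ∎
    where
    open ≡-Reasoning
    k = length ys
    lt₁ : suc (length (frames ys)) < #sender
    lt₁ = <-trans (n<1+n _) lt
    lt₂ : length (frames ys) < #sender
    lt₂ = <-trans (n<1+n _) lt₁
    state≡ : ∀ j (p : j + length (frames ys) < #sender) → toℕ (fromℕ< p) ≡ j + k * 2
    state≡ j p = trans (toℕ-fromℕ< p) (cong (j +_) (length-frames ys))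
    rest item₁ item₂ : List Bool
    rest  = encodeItems encodeRule (loadRules (frames ys) lt₂)
    item₁ = true ∷ encodeRule (rule (fromℕ< lt) r (msg ★) (fromℕ< lt₁))
    item₂ = true ∷ encodeRule (rule (fromℕ< lt₁) r (msg (letter y)) (fromℕ< lt₂))

  -- A record, so that template and code can be inferred from a proof.

  record Yields (x : List Sign) (u : List Bool) : Set where
    constructor yields
    field equation : instantiate n x ≡ u

  open Yields

  infixr 5 _⊕_

  _⊕_ : ∀ {x y u v} → Yields x u → Yields y v → Yields (x ++ y) (u ++ v)
  _⊕_ {x} p q = yields (trans (instantiate-++ n x _) (cong₂ _++_ (equation p) (equation q)))

  literal : ∀ w → Yields (lit w) w
  literal w = yields (instantiate-lit n w)

  fixedItems loadItems : List Bool
  fixedItems = encodeItems encodeRule (entry ∷ map shift nodeRules)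
  loadItems  = encodeItems encodeRule (loadRules feed ℓ<#sender)

  program-yields : Yields program
    (encodeℕ #msgs ++ encodeℕ #sender ++ encodeℕ #receiver ++ encodeFin (fromℕ< ℓ<#sender) ++
     encodeFin (at final) ++ (encodeFin idle ++ encodeFin idle) ++ fixedItems)
  program-yields =
      literal (encodeℕ #msgs) ⊕ yields {bit true ∷ hole ∷ lit (encodeℕ #nodes)} instantiate-#sender
    ⊕ literal (encodeℕ #receiver)
    ⊕ yields {hole ∷ bit false ∷ []} instantiate-p-in
    ⊕ yields {stateTemplate final} (instantiate-state final)
    ⊕ literal (encodeFin idle ++ encodeFin idle)
    ⊕ yields {bit true ∷ entryTemplate} (cong (true ∷_) instantiate-entry)
    ⊕ yields {rulesTemplate nodeRules} (instantiate-rules nodeRules)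

  encode-senderRules : encodeList encodeRule senderRules ≡ fixedItems ++ loadItems ++ [ false ]
  encode-senderRules = trans
    (encodeList-++ encodeRule (entry ∷ map shift nodeRules) (loadRules feed ℓ<#sender))
    (cong (fixedItems ++_) (encodeList-items encodeRule (loadRules feed ℓ<#sender)))

  -- The fixed point: what the automaton computes from its initial queue is the code of the instance
  -- whose chain loads this queue.
  selfCode≡ : selfCode ≡ encode problem
  selfCode≡ = begin
    instantiate n program ++ instantiateBlocks queue ++ tailCode
      ≡⟨ cong₂ (λ u v → u ++ v ++ tailCode) (equation program-yields) (instantiate-blocks queue ℓ<#sender) ⟩
    (a ++ b ++ c ++ d ++ e ++ (f ++ f) ++ fixedItems) ++ loadItems ++ [ false ] ++ receiverCode
      ≡⟨ reassociate a b c d e f fixedItems loadItems [ false ] receiverCode ⟩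
    assemble (fixedItems ++ loadItems ++ [ false ])
      ≡⟨ cong assemble {encodeList encodeRule senderRules} {fixedItems ++ loadItems ++ [ false ]} encode-senderRules ⟨
    assemble (encodeList encodeRule senderRules)
      ≡⟨⟩
    encode problem ∎
    where
    open ≡-Reasoning
    a b c d e f receiverCode : List Bool
    a = encodeℕ #msgs
    b = encodeℕ #sender
    c = encodeℕ #receiver
    d = encodeFin (fromℕ< ℓ<#sender)
    e = encodeFin (at final)
    f = encodeFin idle
    receiverCode = encodeList encodeRule receiverRules
    assemble : List Bool → List Bool
    assemble w = a ++ b ++ c ++ d ++ e ++ f ++ f ++ w ++ receiverCode
    reassociate : ∀ (a b c d e f g h i j : List Bool) →
      (a ++ b ++ c ++ d ++ e ++ (f ++ f) ++ g) ++ h ++ i ++ j ≡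
      a ++ b ++ c ++ d ++ e ++ f ++ f ++ (g ++ h ++ i) ++ j
    reassociate a b c d e f g h i j = solve (++-monoid Bool)

  open Computation T using (Accepts; Rejects)

  rejects⇒reachable : Rejects (encode problem) → E-E-Reach problem
  rejects⇒reachable (_ , σ) = let _ , _ , ρ = simulate-T selfCode≡ rejecting σ in halts⇒reachable ρ

  accepts⇒unreachable : Accepts (encode problem) → ¬ E-E-Reach problem
  accepts⇒unreachable (_ , σ) reach =
    let _ , _ , ρ = simulate-T selfCode≡ accepting σ in
    trap⇒¬halts (λ { (Queue.step refl) → refl }) ρ (proj₂ (reachable⇒halts reach))
    where open QueueProperties next

  -- A constructive argument: reachability would make `T` accept, which excludes it; being thus
  -- refuted, it makes `T` reject, which yields it.
  not-decider : ¬ DecidesE-E-Reach UCST[ 𝒯 ]₁ʳ T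
  not-decider decides = unreachable (rejects⇒reachable (proj₂ verdict unreachable))
    where
    verdict = decides problem system-in-class
    unreachable : ¬ E-E-Reach problem
    unreachable reach = accepts⇒unreachable (proj₁ verdict reach) reach

undecidable : (𝒯 : {m : ℕ} → Reg m → Set) →
  (∀ {A : Set} (finiteA : Finite A) → Tests 𝒯 finiteA) → E-E-ReachUndecidable UCST[ 𝒯 ]₁ʳ
undecidable 𝒯 tests (T , decides) = Diagonal.not-decider 𝒯 tests T decides

theorem3p1 : E-E-ReachUndecidable UCST[ IsParityTest ]₁ʳ
           × E-E-ReachUndecidable UCST[ IsHeadTest ]₁ʳ
theorem3p1 = undecidable IsParityTest parity-tests , undecidable IsHeadTest head-tests
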